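{- The following inequalities hold: (1) $\mathrm{non}(\mathcal{E}^*)\leq\sup\{\mathfrak{d}(\Pi F,\in^*,\mathcal{S}lm(F,b)): F,b\in\omega^\omega \text{ increasing},\ b\leq F\}$; (2) $\mathrm{non}(\mathcal{E}^*)\geq\min\{\mathfrak{d}(\Pi F,\in^*,\mathcal{S}lm(F,b)): F,b\in\omega^\omega\text{ increasing},\ b\leq F,\ \sum_n\frac{b(n)}{F(n)}<\infty\}$.
   Context: $2^\omega$ is the Cantor space with coordinatewise addition modulo 2 and $\mathcal{E}$ is the $\sigma$-ideal on $2^\omega$ generated by closed Lebesgue measure zero sets. $\mathcal{E}^*=\{X\subseteq 2^\omega:\forall E\in\mathcal{E}\ X+E\neq 2^\omega\}$, where $X+E=\{x+e:x\in X,e\in E\}$, and $\mathrm{non}(\mathcal{E}^*)=\min\{|X|: X\subseteq 2^\omega,\ X\notin\mathcal{E}^*\}$. A function $f\in\omega^\omega$ is increasing if $f(n)<f(n+1)$ for all $n$; we assume $F(n)\geq1$ for all $n$; $b\leq F$ means $b(n)\leq F(n)$ for all $n$. $\Pi F=\prod_{n\in\omega}F(n)=\{x\in\omega^\omega: x(n)<F(n)\text{ for all } n\}$. $\mathcal{S}lm(F,b)$ is the set of functions $S$ with domain $\omega$ such that $S(n)\in[F(n)]^{b(n)}$ (a subset of $F(n)=\{0,\dots,F(n)-1\}$ of size $b(n)$) for every $n$. For $x\in\Pi F$ and $S\in\mathcal{S}lm(F,b)$, $x\in^*S$ means $x(n)\in S(n)$ for all but finitely many $n$. $\mathfrak{d}(\Pi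 F,\in^*,\mathcal{S}lm(F,b))$ is the least size of a family $\mathcal{Z}\subseteq\mathcal{S}lm(F,b)$ such that every $x\in\Pi F$ satisfies $x\in^*S$ for some $S\in\mathcal{Z}$. -}

module Defs where

open import Agda.Primitive using (Setω)
open import Axiom.ExcludedMiddle using (ExcludedMiddle)
open import Data.Bool.Base using (Bool; _xor_)
open import Data.Fin.Base using (Fin)
open import Data.Fin.Subset using (Subset; ∣_∣; _∈_)
open import Data.Integer.Base using (+_)
open import Data.Nat.Base using (ℕ; zero; suc; >-nonZero)
  renaming (_≤_ to _≤ℕ_; _<_ to _<ℕ_)
open import Data.Product.Base using (Σ; Σ-syntax; ∃-syntax; _×_; proj₁)
open import Data.Rational.Base using (ℚ; 0ℚ; 1ℚ; ½; _+_; _*_; _/_; _≤_; _<_)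
open import Function.Bundles using (Func; Injection; Surjection; Bijection)
open import Level using (0ℓ; _⊔_) renaming (suc to lsuc)
open import Relation.Binary.Bundles using (Setoid)
import Relation.Binary.Construct.On as On
open import Relation.Binary.PropositionalEquality
  using (_≡_; refl; sym; trans; _→-setoid_)
open import Relation.Nullary.Negation using (¬_)
open import Relation.Unary using (Pred; _⊆_; ∁; ⋃) renaming (_∈_ to _∈ₚ_)

-- The ambient theory is ZFC.  Excluded middle and choice are not available in
-- Agda, so they are stated here in order to be assumed.  Sets are setoids;
-- choice says that surjections of setoids have sections respecting the setoid
-- equalities (unlike the type-theoretic form, this is not provable).

Classical : Setω
Classical = ∀ ℓ → ExcludedMiddle ℓ

AxiomOfChoice : Setω
AxiomOfChoice =
  ∀ {a ℓ₁ b ℓ₂} {A : Setoid a ℓ₁} {B : Setoid b ℓ₂} (f : Surjection A B) →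
  Σ[ g ∈ Func B A ]
    (∀ y → Setoid._≈_ B (Surjection.to f (Func.to g y)) y)

-- A cardinal is represented by any set having that cardinality, so cardinals
-- are taken up to _≃_.

Cardinal : Set₁
Cardinal = Setoid 0ℓ 0ℓ

_≲_ : Cardinal → Cardinal → Set
κ ≲ μ = Injection κ μ

_≃_ : Cardinal → Cardinal → Set
κ ≃ μ = Bijection κ μ

infix 4 _≲_ _≃_

IsMin : ∀ {ℓ} → Pred Cardinal ℓ → Pred Cardinal (lsuc 0ℓ ⊔ ℓ)
IsMin P κ = P κ × (∀ μ → P μ → κ ≲ μ)

IsSup : ∀ {ℓ} → Pred Cardinal ℓ → Pred Cardinal (lsuc 0ℓ ⊔ ℓ)
IsSup P κ = (∀ μ → P μ → μ ≲ κ) × (∀ ν → (∀ μ → P μ → μ ≲ ν) → κ ≲ ν)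

-- The subset of A given by X.  Two elements are identified when they are equal
-- in A, so neither the proofs of X nor its failure to respect the equality
-- of A affect the cardinality.
subset : (A : Cardinal) → Pred (Setoid.Carrier A) 0ℓ → Cardinal
subset A X = On.setoid {B = Σ _ X} A proj₁

-- The set of cardinalities of those X ⊆ A that satisfy P.
Sizes : ∀ {ℓ} (A : Cardinal) → Pred (Pred (Setoid.Carrier A) 0ℓ) ℓ →
        Pred Cardinal (lsuc 0ℓ ⊔ ℓ)
Sizes A P κ = ∃[ X ] P X × κ ≃ subset A X

Cantor : Set
Cantor = ℕ → Bool

2^ω : Cardinal
2^ω = ℕ →-setoid Bool

open Setoid 2^ω public using () renaming (_≈_ to _≐_)

_⊕_ : Cantor → Cantor → Cantor
(x ⊕ y) n = x n xor y n

infixl 6 _⊕_ _⊞_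

_⊞_ : Pred Cantor 0ℓ → Pred Cantor 0ℓ → Pred Cantor 0ℓ
(X ⊞ E) z = ∃[ x ] ∃[ e ] x ∈ₚ X × e ∈ₚ E × z ≐ x ⊕ e

-- y lies in the basic clopen set [x↾n].
_∈[_↾_] : Cantor → Cantor → ℕ → Set
y ∈[ x ↾ n ] = ∀ i → i <ℕ n → y i ≡ x i

Open : Pred Cantor 0ℓ → Set
Open U = ∀ x → x ∈ₚ U → ∃[ n ] (∀ y → y ∈[ x ↾ n ] → y ∈ₚ U)

Closed : Pred Cantor 0ℓ → Set
Closed C = Open (∁ C)

∑ : (ℕ → ℚ) → ℕ → ℚ
∑ f zero    = 0ℚ
∑ f (suc n) = ∑ f n + f n

½^ : ℕ → ℚ
½^ zero    = 1ℚ
½^ (suc n) = ½ * ½^ n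

-- Outer Lebesgue measure zero: for each ε > 0 there is a countable cover by
-- basic sets [c i ↾ k i], of measure 2^(- k i), of total measure at most ε.
Null : Pred Cantor 0ℓ → Set
Null A = ∀ ε → 0ℚ < ε →
  Σ[ c ∈ (ℕ → Cantor) ] Σ[ k ∈ (ℕ → ℕ) ]
    (∀ x → x ∈ₚ A → ∃[ i ] x ∈[ c i ↾ k i ]) ×
    (∀ n → ∑ (λ i → ½^ (k i)) n ≤ ε)

data ℰ : Pred Cantor 0ℓ → Set₁ where
  closedNull : ∀ {C} → Closed C → Null C → ℰ C
  subset-∈   : ∀ {A B} → A ⊆ B → ℰ B → ℰ A
  union-∈    : ∀ {A : ℕ → Pred Cantor 0ℓ} → (∀ n → ℰ (A n)) → ℰ (⋃ ℕ A)

ℰ* : Pred (Pred Cantor 0ℓ) (lsuc 0ℓ)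
ℰ* X = ∀ E → ℰ E → ¬ (∀ z → z ∈ₚ X ⊞ E)

-- κ = non(ℰ*)
IsNonℰ* : Pred Cardinal (lsuc 0ℓ)
IsNonℰ* = IsMin (Sizes 2^ω (∁ ℰ*))

Π : (ℕ → ℕ) → Set
Π F = ∀ n → Fin (F n)

record Slm (F b : ℕ → ℕ) : Set where
  field
    at   : ∀ n → Subset (F n)
    size : ∀ n → ∣ at n ∣ ≡ b n

open Slm public

SlmSet : (F b : ℕ → ℕ) → Cardinal
SlmSet F b = record
  { Carrier       = Slm F b
  ; _≈_           = λ S T → ∀ n → at S n ≡ at T n
  ; isEquivalence = record
    { refl  = λ n → refl
    ; sym   = λ p n → sym (p n)
    ; trans = λ p q n → trans (p n) (q n)
    }
  }

_∈*_ : ∀ {F b} → Π F → Slm F b → Set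
x ∈* S = ∃[ m ] (∀ n → m ≤ℕ n → x n ∈ at S n)

infix 4 _∈*_

Dominating : ∀ F b → Pred (Slm F b) 0ℓ → Set
Dominating F b Z = ∀ (x : Π F) → ∃[ S ] S ∈ₚ Z × x ∈* S

-- κ = 𝔡(ΠF, ∈*, Slm(F,b))
Is𝔡 : (F b : ℕ → ℕ) → Pred Cardinal (lsuc 0ℓ)
Is𝔡 F b = IsMin (Sizes (SlmSet F b) (Dominating F b))

Increasing : (ℕ → ℕ) → Set
Increasing f = ∀ n → f n <ℕ f (suc n)

record Admissible (F b : ℕ → ℕ) : Set where
  field
    F-increasing : Increasing F
    b-increasing : Increasing b
    F≥1          : ∀ n → 1 ≤ℕ F n
    b≤F          : ∀ n → b n ≤ℕ F n

-- ∑ₙ b(n)/F(n) < ∞: the terms are nonnegative, so convergence means that the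
-- partial sums are bounded.
Summable : ∀ {F b} → Admissible F b → Set
Summable {F} {b} adm =
  ∃[ B ] (∀ N → ∑ (λ n → _/_ (+ b n) (F n) {{>-nonZero (F≥1 n)}}) N ≤ B)
  where open Admissible adm

-- {𝔡(ΠF, ∈*, Slm(F,b)) : F, b increasing, b ≤ F}
𝔡s : Pred Cardinal (lsuc 0ℓ)
𝔡s κ = ∃[ F ] ∃[ b ] Admissible F b × Is𝔡 F b κ

-- {𝔡(ΠF, ∈*, Slm(F,b)) : F, b increasing, b ≤ F, ∑ₙ b(n)/F(n) < ∞}
summable-𝔡s : Pred Cardinal (lsuc 0ℓ)
summable-𝔡s κ = ∃[ F ] ∃[ b ] Σ[ adm ∈ Admissible F b ] Summable adm × Is𝔡 F b κ

{-# OPTIONS --safe #-}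

-- A maximal clique of simultaneous partial injections shows that any family of
-- sets has a member of least cardinality; hence the numbers 𝔡(ΠF, ∈*, Slm(F,b))
-- exist, and it suffices to compare families for a single pair (F, b).
--
-- (1) Cut ω into blocks, block t having length p t with 2^(p t) ≈ t + 1.  Take
-- b(n) = n and let F(n) code initial segments of z ∈ 2^ω that are long enough to
-- contain all blocks of length n.  As n < 2^n, a slalom S yields x ∈ 2^ω
-- disagreeing on every block of length n with all members of S(n).  If the codes
-- of z are captured by S, then x + z is nonzero on almost all blocks, and the set
-- of such points is in ℰ because ∏ (1 − 1/(t+1)) = 0.
--
-- (2) Let X + E = 2^ω with E ⊆ ⋃ Cᵢ and Cᵢ closed null.  By compactness one can
-- cut ω into intervals such that the trace of C₀ ∪ … ∪ C_k on the k-th has at most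
-- 2^(-k-1) of the possible elements.  Translating these traces by x ∈ X gives
-- slaloms S_x, and every z = x + e is captured by S_x.

module Submission where

open import Defs
open import Algebra.Bundles using (CommutativeRing)
open import Data.Bool.Base using (Bool; true; false; T; _xor_)
open import Data.Bool.Properties using (xor-same; xor-assoc; xor-identityˡ)
open import Data.Empty using (⊥-elim)
open import Data.Fin.Base as Fin using (Fin; toℕ; fromℕ<; finToFun; funToFin)
import Data.Fin.Properties as Finₚ
open import Data.Fin.Subset using (Subset; ∣_∣; _∈_; inside; outside; ⁅_⁆; _∪_; ⊤)
  renaming (_⊆_ to _⊆ₛ_; ⊥ to ∅)
import Data.Fin.Subset.Properties as Subₚ
open import Data.Integer.Base as ℤ using (+[1+_]; -[1+_]; +≤+)
import Data.Integer.Properties as ℤₚ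
open import Data.List.Base using (List; []; _∷_; _++_; [_]; length; concatMap; lookup)
open import Data.List.Properties using (length-++)
open import Data.List.Relation.Unary.Any as Any using (Any; here; there)
open import Data.List.Relation.Unary.Any.Properties
  using (++⁺ˡ; ++⁺ʳ; lookup-index; concatMap⁺)
open import Data.Nat.Base as ℕ using (ℕ; zero; suc; z≤n; s≤s; _⊔_)
  renaming (_+_ to _+ℕ_; _*_ to _*ℕ_; _^_ to _^ℕ_; _≤_ to _≤ℕ_; _<_ to _<ℕ_; _∸_ to _∸ℕ_)
import Data.Nat.Properties as ℕₚ
open import Data.Product.Base using (Σ; Σ-syntax; ∃; ∃-syntax; _×_; _,_; proj₁; proj₂)
open import Data.Rational.Base
  using (ℚ; mkℚ; 0ℚ; 1ℚ; ½; _+_; _*_; _/_; _≤_; _<_; toℚᵘ; *<*; Positive; NonNegative; nonNegative)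
import Data.Rational.Properties as ℚₚ
open import Data.Rational.Solver using (module +-*-Solver)
open import Data.Rational.Unnormalised.Base as ℚᵘ using (mkℚᵘ; *≡*; *≤*) renaming (_≃_ to _≃ᵘ_)
import Data.Rational.Unnormalised.Properties as ℚᵘₚ
open import Data.Sum.Base using (_⊎_; inj₁; inj₂; [_,_]′)
open import Data.Vec.Base using ([]; _∷_; here; there)
open import Function.Base using (_∘_; id)
open import Function.Bundles using (Func; Surjection; Inverse)
import Function.Construct.Composition as Comp
import Function.Construct.Identity as Id
import Function.Construct.Symmetry as Symm
open import Function.Properties.Bijection using (Bijection⇒Inverse)
open import Function.Properties.Inverse using (Inverse⇒Injection)
open import Level using (Level; 0ℓ; Lift; lift)
open import Relation.Binary.Bundles using (Setoid)
open import Relation.Binary.Definitions using (tri<; tri≈; tri>)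
open import Relation.Binary.PropositionalEquality
  using (_≡_; _≢_; _≗_; refl; sym; trans; cong; cong₂; subst; setoid; _→-setoid_; module ≡-Reasoning)
open import Relation.Nullary using (¬_; Dec; yes; no; contradiction)
open import Relation.Nullary.Decidable using (isYes; toWitness; fromWitness; decidable-stable)
open import Relation.Unary using (Pred; ∁; ⋃; U) renaming (_∈_ to _∈ₚ_; _∪_ to _∪ₚ_)
open import Algebra.Properties.Semiring.Mult (CommutativeRing.semiring ℚₚ.+-*-commutativeRing)
  using (×-homo-+; ×1-homo-*) renaming (_×_ to _·_)

-- Cardinals

private variable
  a r ℓ₁ : Level

module Logic (em : Classical) where

  lem : {P : Set ℓ₁} → Dec P
  lem = em _

  by-contradiction : {P : Set ℓ₁} → ¬ ¬ P → P
  by-contradiction = decidable-stable lem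

  ¬∀⇒∃¬ : {A : Set a} {P : A → Set ℓ₁} → ¬ (∀ x → P x) → ∃[ x ] ¬ P x
  ¬∀⇒∃¬ ¬all = by-contradiction λ none →
    ¬all λ x → by-contradiction λ ¬Px → none (x , ¬Px)

  -- Subsets coded by Bool-valued functions, so that the power set of A stays
  -- in the universe of A.
  Sub : Set a → Set a
  Sub A = A → Bool

  ⟦_⟧ : {A : Set a} → Pred A ℓ₁ → Sub A
  ⟦ P ⟧ x = isYes (lem {P = P x})

  module _ {A : Set a} where
    infix 4 _∈ᵇ_ _⊆ᵇ_

    -- A record rather than `T (R x)` itself, so that `x` and `R` can be inferred from a membership
    -- proof.
    record _∈ᵇ_ (x : A) (R : Sub A) : Set where
      constructor is-true
      field holds : T (R x)
    open _∈ᵇ_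

    _⊆ᵇ_ : Sub A → Sub A → Set a
    R ⊆ᵇ Q = ∀ {x} → x ∈ᵇ R → x ∈ᵇ Q

    ∈⟦⟧⁺ : {P : Pred A ℓ₁} → ∀ {x} → P x → x ∈ᵇ ⟦ P ⟧
    ∈⟦⟧⁺ Px = is-true (fromWitness Px)

    ∈⟦⟧⁻ : (P : Pred A ℓ₁) → ∀ {x} → x ∈ᵇ ⟦ P ⟧ → P x
    ∈⟦⟧⁻ P x∈ = toWitness (holds x∈)

    ≗⇒⊆ᵇ : ∀ {R Q : Sub A} → R ≗ Q → R ⊆ᵇ Q
    ≗⇒⊆ᵇ R≗Q {x} x∈R = is-true (subst T (R≗Q x) (holds x∈R))

    ⊆ᵇ-antisym : ∀ {R Q : Sub A} → R ⊆ᵇ Q → Q ⊆ᵇ R → R ≗ Q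
    ⊆ᵇ-antisym {R} {Q} R⊆Q Q⊆R x with R x in p | Q x in q
    ... | true  | true  = refl
    ... | false | false = refl
    ... | true  | false = ⊥-elim (subst T q (holds (R⊆Q (is-true (subst T (sym p) _)))))
    ... | false | true  = ⊥-elim (subst T p (holds (Q⊆R (is-true (subst T (sym q) _)))))

  InSome : {A : Set a} → Sub (Sub A) → Pred A a
  InSome J x = ∃[ R ] R ∈ᵇ J × x ∈ᵇ R

  ⋃ᵇ : {A : Set a} → Sub (Sub A) → Sub A
  ⋃ᵇ J = ⟦ InSome J ⟧

  module Choice (ac : AxiomOfChoice) where

    -- The identity from the carrier with `_≡_` onto `S` is a surjection; a section respecting `_≈_`
    -- chooses one representative in each class.
    canonical : (S : Setoid a ℓ₁) → let open Setoid S in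
                Σ[ f ∈ (Carrier → Carrier) ]
                  (∀ x → f x ≈ x) × (∀ {x y} → x ≈ y → f x ≡ f y)
    canonical S = Func.to g , g-section , Func.cong g
      where
      open Setoid S using (Carrier; reflexive)
      quotient : Surjection (setoid Carrier) S
      quotient = record
        { to = id ; cong = reflexive ; surjective = λ y → y , reflexive }
      g = proj₁ (ac quotient)
      g-section = proj₂ (ac quotient)

    -- Zermelo's tower: the least family of cliques closed under unions and
    -- under adjoining a chosen compatible element is a chain, so its union is
    -- a maximal clique.
    module MaximalClique {A : Set a} (_~_ : A → A → Set r)
      (~-refl : ∀ {x} → x ~ x) (~-sym : ∀ {x y} → x ~ y → y ~ x) where

      Candidate : Sub A → Pred A _
      Candidate R x = ¬ x ∈ᵇ R × (∀ {y} → y ∈ᵇ R → y ~ x)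

      extension : ∀ R → Dec (∃ (Candidate R)) → Pred A a
      extension R (yes (c , _)) x = (x ∈ᵇ R) ⊎ x ≡ c
      extension R (no _)        x = Lift a (x ∈ᵇ R)

      -- Pointwise equal codes need not be propositionally equal. Passing to representatives makes
      -- the chosen candidate depend only on the set coded.
      canon : Sub A → Sub A
      canon = proj₁ (canonical (A →-setoid Bool))

      canon-≗ : ∀ R → canon R ≗ R
      canon-≗ = proj₁ (proj₂ (canonical (A →-setoid Bool)))

      canon-cong : ∀ {R Q} → R ≗ Q → canon R ≡ canon Q
      canon-cong = proj₂ (proj₂ (canonical (A →-setoid Bool)))

      extend : Sub A → Sub A
      extend R = ⟦ extension R lem ⟧

      step : Sub A → Sub A
      step = extend ∘ canon

      ⊆-extension : ∀ R d {x} → x ∈ᵇ R → extension R d x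
      ⊆-extension R (yes _) = inj₁
      ⊆-extension R (no _)  = lift

      ⊆-step : ∀ R → R ⊆ᵇ step R
      ⊆-step R = ∈⟦⟧⁺ ∘ ⊆-extension (canon R) lem ∘ ≗⇒⊆ᵇ (sym ∘ canon-≗ R)

      extension-new : ∀ R d {x y} → extension R d x → ¬ x ∈ᵇ R →
                      extension R d y → (y ∈ᵇ R) ⊎ y ≡ x
      extension-new R (yes _) (inj₁ x∈R) x∉R _          = contradiction x∈R x∉R
      extension-new R (yes _) _          x∉R (inj₁ y∈R) = inj₁ y∈R
      extension-new R (yes _) (inj₂ p)   x∉R (inj₂ q)   = inj₂ (trans q (sym p))
      extension-new R (no _)  (lift x∈R) x∉R _    = contradiction x∈R x∉R

      step-new : ∀ R {x y} → x ∈ᵇ step R → ¬ x ∈ᵇ R →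
                 y ∈ᵇ step R → (y ∈ᵇ R) ⊎ y ≡ x
      step-new R x∈ x∉ y∈
        with extension-new (canon R) lem (∈⟦⟧⁻ (extension (canon R) lem) x∈)
               (x∉ ∘ ≗⇒⊆ᵇ (canon-≗ R)) (∈⟦⟧⁻ (extension (canon R) lem) y∈)
      ... | inj₁ y∈R = inj₁ (≗⇒⊆ᵇ (canon-≗ R) y∈R)
      ... | inj₂ y≡x = inj₂ y≡x

      -- A step adds at most one element, so an element of `Q` outside `R` is the added one.
      no-intermediate : ∀ R Q → R ⊆ᵇ Q → Q ⊆ᵇ step R → (step R ⊆ᵇ Q) ⊎ (Q ⊆ᵇ R)
      no-intermediate R Q R⊆Q Q⊆sR with lem {P = ∃[ x ] x ∈ᵇ Q × ¬ x ∈ᵇ R}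
      ... | yes (x , x∈Q , x∉R) = inj₁ λ y∈ →
              [ R⊆Q , (λ { refl → x∈Q }) ]′ (step-new R (Q⊆sR x∈Q) x∉R y∈)
      ... | no none = inj₂ λ {x} x∈Q → by-contradiction λ x∉R → none (x , x∈Q , x∉R)

      -- The empty set enters as the union of the empty family.
      data Tower : Sub A → Set a where
        next  : ∀ {R} → Tower R → Tower (step R)
        union : ∀ J → (∀ R → R ∈ᵇ J → Tower R) → Tower (⋃ᵇ J)

      ⊆-⋃ : ∀ {J : Sub (Sub A)} {R} → R ∈ᵇ J → R ⊆ᵇ ⋃ᵇ J
      ⊆-⋃ {R = R} R∈J x∈R = ∈⟦⟧⁺ (R , R∈J , x∈R)

      ⋃-⊆ : ∀ {J : Sub (Sub A)} {Q} → (∀ R → R ∈ᵇ J → R ⊆ᵇ Q) → ⋃ᵇ J ⊆ᵇ Q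
      ⋃-⊆ all x∈ with ∈⟦⟧⁻ (InSome _) x∈
      ... | R , R∈J , x∈R = all R R∈J x∈R

      -- Mutual induction: `comparable` descends in the tower of `R`, `above` in that of `Q`. Once
      -- `R ⊆ᵇ Q`, `above` decides whether one more step from `R` stays inside `Q`.
      comparable : ∀ {Q R} → Tower Q → Tower R → (R ⊆ᵇ Q) ⊎ (step Q ⊆ᵇ R)
      above : ∀ {Q R} → Tower Q → Tower R → R ⊆ᵇ Q → (step R ⊆ᵇ Q) ⊎ (Q ⊆ᵇ R)

      comparable {Q} tQ (union J tJ) with lem {P = ∃[ R ] R ∈ᵇ J × step Q ⊆ᵇ R}
      ... | yes (R , R∈J , sQ⊆R) = inj₂ (⊆-⋃ R∈J ∘ sQ⊆R)
      ... | no none = inj₁ (⋃-⊆ λ R R∈J →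
              [ id , (λ sQ⊆R → contradiction (R , R∈J , λ {x} → sQ⊆R {x}) none) ]′
                (comparable tQ (tJ R R∈J)))
      comparable {Q} tQ (next {R} tR) with comparable tQ tR
      ... | inj₂ sQ⊆R = inj₂ (⊆-step R ∘ sQ⊆R)
      ... | inj₁ R⊆Q with above tQ tR R⊆Q
      ...   | inj₁ sR⊆Q = inj₁ sR⊆Q
      -- Here `Q` and `R` are pointwise equal, so they have the same representative and hence the
      -- same step.
      ...   | inj₂ Q⊆R  = inj₂ (subst (step Q ⊆ᵇ_)
                (cong extend (canon-cong (⊆ᵇ-antisym Q⊆R R⊆Q))) id)

      above {Q} {R} (next {Q′} tQ′) tR R⊆Q with comparable tQ′ (next tR)
      ... | inj₁ sR⊆Q′ = inj₁ (⊆-step Q′ ∘ sR⊆Q′)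
      ... | inj₂ Q⊆sR  = no-intermediate R Q R⊆Q Q⊆sR
      above {Q} {R} (union J tJ) tR R⊆Q with lem {P = ∃[ P ] P ∈ᵇ J × step R ⊆ᵇ P}
      ... | yes (P , P∈J , sR⊆P) = inj₁ (⊆-⋃ P∈J ∘ sR⊆P)
      ... | no none = no-intermediate R Q R⊆Q (⋃-⊆ λ P P∈J →
              [ (λ sR⊆P → contradiction (P , P∈J , λ {x} → sR⊆P {x}) none)
              , (λ sP⊆sR x∈P → sP⊆sR (⊆-step P x∈P))
              ]′ (comparable (tJ P P∈J) (next tR)))

      extension-clique : ∀ R d → (∀ {x y} → x ∈ᵇ R → y ∈ᵇ R → x ~ y) →
                         ∀ {x y} → extension R d x → extension R d y → x ~ y
      extension-clique R (yes _) cl (inj₁ x∈R) (inj₁ y∈R)   = cl x∈R y∈R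
      extension-clique R (yes (_ , _ , c)) cl (inj₁ x∈R) (inj₂ refl)  = c x∈R
      extension-clique R (yes (_ , _ , c)) cl (inj₂ refl) (inj₁ y∈R)  = ~-sym (c y∈R)
      extension-clique R (yes _) cl (inj₂ refl) (inj₂ refl) = ~-refl
      extension-clique R (no _) cl (lift x∈R) (lift y∈R) = cl x∈R y∈R

      tower-clique : ∀ {R} → Tower R → ∀ {x y} → x ∈ᵇ R → y ∈ᵇ R → x ~ y
      tower-clique (next {R} tR) x∈ y∈ =
        extension-clique (canon R) lem
          (λ p q → tower-clique tR (≗⇒⊆ᵇ (canon-≗ R) p) (≗⇒⊆ᵇ (canon-≗ R) q))
          (∈⟦⟧⁻ (extension (canon R) lem) x∈) (∈⟦⟧⁻ (extension (canon R) lem) y∈)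
      tower-clique (union J tJ) x∈ y∈ with ∈⟦⟧⁻ (InSome J) x∈ | ∈⟦⟧⁻ (InSome J) y∈
      ... | R , R∈J , x∈R | Q , Q∈J , y∈Q with comparable (tJ Q Q∈J) (tJ R R∈J)
      ...   | inj₁ R⊆Q  = tower-clique (tJ Q Q∈J) (R⊆Q x∈R) y∈Q
      ...   | inj₂ sQ⊆R = tower-clique (tJ R R∈J) x∈R (sQ⊆R (⊆-step Q y∈Q))

      clique : Sub A
      clique = ⋃ᵇ ⟦ Tower ⟧

      clique-tower : Tower clique
      clique-tower = union ⟦ Tower ⟧ λ R → ∈⟦⟧⁻ Tower

      extension-proper : ∀ R d → ∃ (Candidate R) → ∃[ x ] extension R d x × ¬ x ∈ᵇ R
      extension-proper R (yes (x , x∉R , _)) _ = x , inj₂ refl , x∉R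
      extension-proper R (no none) c = contradiction c none

      -- The step after the union of the tower lies in the tower again, hence inside that union; a
      -- compatible element outside would make it strictly larger.
      clique-maximal : ∀ {x} → (∀ {y} → y ∈ᵇ clique → y ~ x) → x ∈ᵇ clique
      clique-maximal {x} all~x = by-contradiction λ x∉ →
        let y , y∈ , y∉ = extension-proper (canon clique) lem
              (x , x∉ ∘ ≗⇒⊆ᵇ (canon-≗ clique) , all~x ∘ ≗⇒⊆ᵇ (canon-≗ clique))
        in y∉ (≗⇒⊆ᵇ (sym ∘ canon-≗ clique)
                 (⊆-⋃ (∈⟦⟧⁺ (next clique-tower)) (∈⟦⟧⁺ y∈)))

    -- A maximal clique of simultaneous partial injections between the κ i
    -- must exhaust some κ i.
    module _ {I : Set a} (κ : I → Cardinal) where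
      private
        module κ i = Setoid (κ i)
        -- Two functions are compatible if they agree at every index or at none, so a clique matches
        -- points of all the `κ i` injectively.
        open MaximalClique {A = ∀ i → κ.Carrier i}
          (λ f g → ∀ i j → κ._≈_ i (f i) (g i) → κ._≈_ j (f j) (g j))
          (λ _ _ p → κ.refl _)
          (λ f~g i j p → κ.sym j (f~g i j (κ.sym i p)))

        Hit : ∀ i → Pred (κ.Carrier i) _
        Hit i x = ∃[ f ] f ∈ᵇ clique × κ._≈_ i (f i) x

      least-cardinal : I → ∃[ i ] (∀ j → κ i ≲ κ j)
      least-cardinal i₀ with lem {P = ∃[ i ] (∀ x → Hit i x)}
      ... | yes (i , hit) = i , λ j → record
            { to        = λ x → proj₁ (hit x) j
            ; cong      = λ {x} {y} x≈y →
                let f , f∈ , fx = hit x ; g , g∈ , gy = hit y in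
                tower-clique clique-tower f∈ g∈ i j
                  (κ.trans i fx (κ.trans i x≈y (κ.sym i gy)))
            ; injective = λ {x} {y} fj≈gj →
                let f , f∈ , fx = hit x ; g , g∈ , gy = hit y in
                κ.trans i (κ.sym i fx)
                  (κ.trans i (tower-clique clique-tower f∈ g∈ j i fj≈gj) gy)
            }
      -- If every `κ i` has a point that is not hit, these points form a function compatible with
      -- the whole clique, which by maximality belongs to it.
      ... | no none = contradiction (x , x∈ , κ.refl i₀) (proj₂ (missed i₀))
        where
        missed : ∀ i → ∃[ x ] ¬ Hit i x
        missed i = ¬∀⇒∃¬ λ hit → none (i , hit)
        x : ∀ i → κ.Carrier i
        x i = proj₁ (missed i)
        x∈ : x ∈ᵇ clique
        x∈ = clique-maximal λ {f} f∈ i j p →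
          contradiction (f , f∈ , p) (proj₂ (missed i))

    -- Comparison of cardinals by choice

    ≲-trans : ∀ {κ μ ν} → κ ≲ μ → μ ≲ ν → κ ≲ ν
    ≲-trans = Comp.injection

    ≃⇒≳ : ∀ {κ μ} → κ ≃ μ → μ ≲ κ
    ≃⇒≳ = Inverse⇒Injection ∘ Symm.inverse ∘ Bijection⇒Inverse

    -- The family compared is that of all subsets satisfying `P`, a large index type.
    min-exists : ∀ {A} {P : Pred (Pred (Setoid.Carrier A) 0ℓ) ℓ₁} {X} → P X →
                 ∃ (IsMin (Sizes A P))
    min-exists {A = A} {P} {X} PX =
      let (Y , PY) , least = least-cardinal {I = ∃ P} (subset A ∘ proj₁) (X , PX)
      in subset A Y , (Y , PY , Id.bijection _) ,
         λ μ (Z , PZ , μ≃Z) → ≲-trans (least (Z , PZ)) (≃⇒≳ μ≃Z)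

    surjection⇒≳ : ∀ {κ μ} → Surjection κ μ → μ ≲ κ
    surjection⇒≳ {κ} {μ} f = let g , f∘g = ac f in record
      { to        = Func.to g
      ; cong      = Func.cong g
      ; injective = λ {x} {y} p →
          trans′ (sym′ (f∘g x)) (trans′ (Surjection.cong f p) (f∘g y))
      }
      where open Setoid μ using () renaming (trans to trans′; sym to sym′)

    image : ∀ {A B : Cardinal} → (Setoid.Carrier A → Setoid.Carrier B) →
            Pred (Setoid.Carrier A) 0ℓ → Pred (Setoid.Carrier B) 0ℓ
    image {B = B} f X y = ∃[ x ] x ∈ₚ X × Setoid._≈_ B (f x) y

    image-≲ : ∀ {A B : Cardinal} (f : Func A B) (X : Pred (Setoid.Carrier A) 0ℓ) →
              subset B (image {A} {B} (Func.to f) X) ≲ subset A X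
    image-≲ {A} {B} f X = surjection⇒≳ {subset A X} record
      { to         = λ (x , x∈X) → Func.to f x , x , x∈X , Setoid.refl B
      ; cong       = Func.cong f
      ; surjective = λ (y , x , x∈X , fx≈y) → (x , x∈X) ,
          λ z≈x → Setoid.trans B (Func.cong f z≈x) fx≈y
      }

    -- Evaluating at representatives makes any function respect the setoid equality; this serves the
    -- constructions `slalom` and `avoider`.
    respectful : ∀ {A B : Cardinal} → (Setoid.Carrier A → Setoid.Carrier B) → Func A B
    respectful {A} {B} f = let r , _ , r-cong = canonical A in record
      { to = f ∘ r ; cong = Setoid.reflexive B ∘ cong f ∘ r-cong }

-- Powers of ½

2^_ : ℕ → ℕ
2^ n = 2 ^ℕ n

m<2^m : ∀ m → m <ℕ 2^ m
m<2^m zero    = s≤s z≤n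
m<2^m (suc m) = ℕₚ.≤-trans (ℕₚ.+-mono-≤ (ℕₚ.m^n>0 2 m) (m<2^m m))
  (ℕₚ.+-monoʳ-≤ (2^ m) (ℕₚ.m≤m+n (2^ m) 0))

½^-positive : ∀ n → Positive (½^ n)
½^-positive zero    = _
½^-positive (suc n) = ℚₚ.pos*pos⇒pos ½ (½^ n) {{½^-positive n}}

½^-nonNegative : ∀ n → NonNegative (½^ n)
½^-nonNegative n = ℚₚ.pos⇒nonNeg (½^ n) {{½^-positive n}}

½^≥0 : ∀ n → 0ℚ ≤ ½^ n
½^≥0 n = ℚₚ.<⇒≤ (ℚₚ.positive⁻¹ (½^ n) {{½^-positive n}})

½^-+ : ∀ m n → ½^ (m +ℕ n) ≡ ½^ m * ½^ n
½^-+ zero    n = sym (ℚₚ.*-identityˡ (½^ n))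
½^-+ (suc m) n = trans (cong (½ *_) (½^-+ m n)) (sym (ℚₚ.*-assoc ½ (½^ m) (½^ n)))

½^-double : ∀ n → ½^ (suc n) + ½^ (suc n) ≡ ½^ n
½^-double n = trans (sym (ℚₚ.*-distribʳ-+ (½^ n) ½ ½)) (ℚₚ.*-identityˡ (½^ n))

toℚᵘ-½^ : ∀ n → toℚᵘ (½^ n) ≃ᵘ (ℤ.+ 1 ℚᵘ./ (2^ n)) {{ℕₚ.m^n≢0 2 n}}
toℚᵘ-½^ zero    = ℚᵘₚ.≃-refl
toℚᵘ-½^ (suc n) = ℚᵘₚ.≃-trans (ℚₚ.toℚᵘ-homo-* ½ (½^ n))
  (ℚᵘₚ.≃-trans (ℚᵘₚ.*-congˡ {toℚᵘ ½} (toℚᵘ-½^ n))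
    (half (2^ n) (ℕₚ.m^n≢0 2 n) (ℕₚ.m^n≢0 2 (suc n))))
  where
  half : ∀ m (m≢0 : ℕ.NonZero m) (2m≢0 : ℕ.NonZero (2 *ℕ m)) →
         mkℚᵘ (ℤ.+ 1) 1 ℚᵘ.* (ℤ.+ 1 ℚᵘ./ m) {{m≢0}} ≃ᵘ (ℤ.+ 1 ℚᵘ./ (2 *ℕ m)) {{2m≢0}}
  half (suc m) _ _ = *≡* refl

/≡½^ : ∀ b f k .{{_ : ℕ.NonZero f}} → b *ℕ 2^ k ≡ f → ℤ.+ b / f ≡ ½^ k
/≡½^ b (suc f) k b2ᵏ≡f = ℚₚ.toℚᵘ-injective (ℚᵘₚ.≃-trans
  (ℚₚ.toℚᵘ-fromℚᵘ (mkℚᵘ (ℤ.+ b) f))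
  (ℚᵘₚ.≃-trans (ratio (2^ k) (ℕₚ.m^n≢0 2 k) b2ᵏ≡f) (ℚᵘₚ.≃-sym (toℚᵘ-½^ k))))
  where
  ratio : ∀ m (m≢0 : ℕ.NonZero m) → b *ℕ m ≡ suc f →
          mkℚᵘ (ℤ.+ b) f ≃ᵘ (ℤ.+ 1 ℚᵘ./ m) {{m≢0}}
  ratio (suc m) _ p = *≡* (trans (sym (ℤₚ.pos-* b (suc m)))
    (trans (cong ℤ.+_ p) (sym (ℤₚ.*-identityˡ (ℤ.+ suc f)))))

½^-small : ∀ ε → 0ℚ < ε → ∃[ e ] ½^ e ≤ ε
½^-small (mkℚ (ℤ.+ zero)    d _) (*<* (ℤ.+<+ ()))
½^-small (mkℚ -[1+ _ ]    d _) (*<* ())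
-- The numerator is at least 1 and the denominator is `suc d`, which is below `2^ (suc d)`.
½^-small (mkℚ +[1+ a ] d c) _ = suc d , ℚₚ.toℚᵘ-cancel-≤ (ℚᵘₚ.≤-respˡ-≃ (ℚᵘₚ.≃-sym (toℚᵘ-½^ (suc d))) bound)
  where
  bound : (ℤ.+ 1 ℚᵘ./ (2^ (suc d))) {{ℕₚ.m^n≢0 2 (suc d)}} ℚᵘ.≤ mkℚᵘ +[1+ a ] d
  bound with 2^ (suc d) | ℕₚ.m^n≢0 2 (suc d) | m<2^m (suc d)
  ... | suc m | _ | d<m = *≤* (+≤+ (subst (_≤ℕ suc a *ℕ suc m) (sym (ℕₚ.+-identityʳ (suc d)))
    (ℕₚ.≤-trans (ℕₚ.<⇒≤ d<m) (ℕₚ.m≤m+n (suc m) (a *ℕ suc m)))))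

ι : ℕ → ℚ
ι n = n · 1ℚ

0≤ι : ∀ n → 0ℚ ≤ ι n
0≤ι zero    = ℚₚ.≤-refl
0≤ι (suc n) = ℚₚ.+-mono-≤ (ℚₚ.nonNegative⁻¹ 1ℚ) (0≤ι n)

ι-mono-≤ : ∀ {m n} → m ≤ℕ n → ι m ≤ ι n
ι-mono-≤ {n = n} z≤n = 0≤ι n
ι-mono-≤ (s≤s m≤n)   = ℚₚ.+-monoʳ-≤ 1ℚ (ι-mono-≤ m≤n)

ι<ι+1 : ∀ n → ι n < ι (suc n)
ι<ι+1 n = subst (_< ι (suc n)) (ℚₚ.+-identityˡ (ι n))
  (ℚₚ.+-monoˡ-< (ι n) (ℚₚ.positive⁻¹ 1ℚ))

ι-cancel-≤ : ∀ {m n} → ι m ≤ ι n → m ≤ℕ n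
ι-cancel-≤ {m} {n} ιm≤ιn = ℕₚ.≮⇒≥ λ n<m →
  ℚₚ.<-irrefl refl (ℚₚ.<-≤-trans (ι<ι+1 n) (ℚₚ.≤-trans (ι-mono-≤ n<m) ιm≤ιn))

ι2^*½^ : ∀ n → ι (2^ n) * ½^ n ≡ 1ℚ
ι2^*½^ zero    = refl
ι2^*½^ (suc n) = begin
  ι (2 *ℕ 2^ n) * (½ * ½^ n)    ≡⟨ cong (_* (½ * ½^ n)) (×1-homo-* 2 (2^ n)) ⟩
  ι 2 * ι (2^ n) * (½ * ½^ n)   ≡⟨ solve 4 (λ a b c d → a :* b :* (c :* d) := a :* c :* (b :* d)) refl (ι 2) (ι (2^ n)) ½ (½^ n) ⟩
  ι 2 * ½ * (ι (2^ n) * ½^ n)   ≡⟨ cong (ι 2 * ½ *_) (ι2^*½^ n) ⟩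
  1ℚ                            ∎
  where open ≡-Reasoning ; open +-*-Solver

ι2^∸*½^ : ∀ {k n} → k ≤ℕ n → ι (2^ (n ∸ℕ k)) * ½^ n ≡ ½^ k
ι2^∸*½^ {k} {n} k≤n = begin
  ι (2^ j) * ½^ n              ≡⟨ cong (λ m → ι (2^ j) * ½^ m) (ℕₚ.m∸n+n≡m k≤n) ⟨
  ι (2^ j) * ½^ (j +ℕ k)       ≡⟨ cong (ι (2^ j) *_) (½^-+ j k) ⟩
  ι (2^ j) * (½^ j * ½^ k)     ≡⟨ ℚₚ.*-assoc (ι (2^ j)) (½^ j) (½^ k) ⟨
  ι (2^ j) * ½^ j * ½^ k       ≡⟨ cong (_* ½^ k) (ι2^*½^ j) ⟩
  1ℚ * ½^ k                    ≡⟨ ℚₚ.*-identityˡ (½^ k) ⟩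
  ½^ k                         ∎
  where open ≡-Reasoning ; j = n ∸ℕ k

ι-nonNegative : ∀ n → NonNegative (ι n)
ι-nonNegative n = nonNegative (0≤ι n)

-- Multiplying by `ι (2^ e) * ι (2^ n)` clears denominators and turns a measure bound into a count
-- of prefixes.
density⇒ℕ : ∀ l n e → ι l * ½^ n ≤ ½^ e → l *ℕ 2^ e ≤ℕ 2^ n
density⇒ℕ l n e bound = ι-cancel-≤ (begin
  ι (l *ℕ 2^ e)                            ≡⟨ ×1-homo-* l (2^ e) ⟩
  ι l * ι (2^ e)                           ≡⟨ ℚₚ.*-identityʳ _ ⟨
  ι l * ι (2^ e) * 1ℚ                      ≡⟨ cong (ι l * ι (2^ e) *_) (ι2^*½^ n) ⟨
  ι l * ι (2^ e) * (ι (2^ n) * ½^ n)       ≡⟨ solve 4 (λ a b c d → a :* b :* (c :* d) := a :* d :* (b :* c)) refl (ι l) (ι (2^ e)) (ι (2^ n)) (½^ n) ⟩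
  ι l * ½^ n * (ι (2^ e) * ι (2^ n))       ≤⟨ ℚₚ.*-monoʳ-≤-nonNeg (ι (2^ e) * ι (2^ n)) {{ℚₚ.nonNeg*nonNeg⇒nonNeg (ι (2^ e)) {{ι-nonNegative (2^ e)}} (ι (2^ n)) {{ι-nonNegative (2^ n)}}}} bound ⟩
  ½^ e * (ι (2^ e) * ι (2^ n))             ≡⟨ solve 3 (λ a b c → a :* (b :* c) := b :* a :* c) refl (½^ e) (ι (2^ e)) (ι (2^ n)) ⟩
  ι (2^ e) * ½^ e * ι (2^ n)               ≡⟨ cong (_* ι (2^ n)) (ι2^*½^ e) ⟩
  1ℚ * ι (2^ n)                            ≡⟨ ℚₚ.*-identityˡ _ ⟩
  ι (2^ n)                                 ∎)
  where open ℚₚ.≤-Reasoning ; open +-*-Solver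

ℕ⇒density : ∀ l n e → l *ℕ 2^ e ≤ℕ 2^ n → ι l * ½^ n ≤ ½^ e
ℕ⇒density l n e bound = begin
  ι l * ½^ n                               ≡⟨ ℚₚ.*-identityʳ _ ⟨
  ι l * ½^ n * 1ℚ                          ≡⟨ cong (ι l * ½^ n *_) (ι2^*½^ e) ⟨
  ι l * ½^ n * (ι (2^ e) * ½^ e)           ≡⟨ solve 4 (λ a b c d → a :* b :* (c :* d) := a :* c :* (b :* d)) refl (ι l) (½^ n) (ι (2^ e)) (½^ e) ⟩
  ι l * ι (2^ e) * (½^ n * ½^ e)           ≡⟨ cong (_* (½^ n * ½^ e)) (×1-homo-* l (2^ e)) ⟨
  ι (l *ℕ 2^ e) * (½^ n * ½^ e)            ≤⟨ ℚₚ.*-monoʳ-≤-nonNeg (½^ n * ½^ e) {{ℚₚ.nonNeg*nonNeg⇒nonNeg (½^ n) {{½^-nonNegative n}} (½^ e) {{½^-nonNegative e}}}} (ι-mono-≤ bound) ⟩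
  ι (2^ n) * (½^ n * ½^ e)                 ≡⟨ ℚₚ.*-assoc (ι (2^ n)) (½^ n) (½^ e) ⟨
  ι (2^ n) * ½^ n * ½^ e                   ≡⟨ cong (_* ½^ e) (ι2^*½^ n) ⟩
  1ℚ * ½^ e                                ≡⟨ ℚₚ.*-identityˡ _ ⟩
  ½^ e                                     ∎
  where open ℚₚ.≤-Reasoning ; open +-*-Solver

-- The geometric series, in the form ∑_{i<n} 2^{-(e+1+i)} = 2^{-e} − 2^{-(e+n)}.
∑-½^ : ∀ e n → ∑ (λ i → ½^ (suc e +ℕ i)) n + ½^ (e +ℕ n) ≡ ½^ e
∑-½^ e zero    = trans (ℚₚ.+-identityˡ _) (cong ½^ (ℕₚ.+-identityʳ e))
∑-½^ e (suc n) = begin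
  s + ½^ (suc e +ℕ n) + ½^ (e +ℕ suc n)      ≡⟨ cong (λ m → s + ½^ (suc e +ℕ n) + ½^ m) (ℕₚ.+-suc e n) ⟩
  s + ½^ (suc e +ℕ n) + ½^ (suc e +ℕ n)      ≡⟨ ℚₚ.+-assoc s _ _ ⟩
  s + (½^ (suc e +ℕ n) + ½^ (suc e +ℕ n))    ≡⟨ cong (s +_) (½^-double (e +ℕ n)) ⟩
  s + ½^ (e +ℕ n)                            ≡⟨ ∑-½^ e n ⟩
  ½^ e                                       ∎
  where open ≡-Reasoning ; s = ∑ (λ i → ½^ (suc e +ℕ i)) n

p≤p+½^ : ∀ p n → p ≤ p + ½^ n
p≤p+½^ p n = subst (_≤ p + ½^ n) (ℚₚ.+-identityʳ p) (ℚₚ.+-monoʳ-≤ p (½^≥0 n))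

∑-½^≤ : ∀ e n → ∑ (λ i → ½^ (suc e +ℕ i)) n ≤ ½^ e
∑-½^≤ e n = ℚₚ.≤-trans (p≤p+½^ _ (e +ℕ n)) (ℚₚ.≤-reflexive (∑-½^ e n))

∑-cong : ∀ {f g} → f ≗ g → ∀ n → ∑ f n ≡ ∑ g n
∑-cong f≗g zero    = refl
∑-cong f≗g (suc n) = cong₂ _+_ (∑-cong f≗g n) (f≗g n)

ι-homo-+ : ∀ m n → ι (m +ℕ n) ≡ ι m + ι n
ι-homo-+ = ×-homo-+ 1ℚ

∑-cons : ∀ f n → ∑ f (suc n) ≡ f 0 + ∑ (λ i → f (suc i)) n
∑-cons f zero    = ℚₚ.+-comm 0ℚ (f 0)
∑-cons f (suc n) = trans (cong (_+ f (suc n)) (∑-cons f n)) (ℚₚ.+-assoc (f 0) _ (f (suc n)))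

-- Finite covers and words

∈-trans : ∀ {x y z n} → x ∈[ y ↾ n ] → y ∈[ z ↾ n ] → x ∈[ z ↾ n ]
∈-trans p q i i<n = trans (p i i<n) (q i i<n)

∈-sym : ∀ {x y n} → x ∈[ y ↾ n ] → y ∈[ x ↾ n ]
∈-sym p i i<n = sym (p i i<n)

infixl 8 _[_≔_]

_[_≔_] : Cantor → ℕ → Bool → Cantor
(x [ n ≔ b ]) i with i ℕₚ.≟ n
... | yes _ = b
... | no  _ = x i

≔-updates : ∀ x n b → (x [ n ≔ b ]) n ≡ b
≔-updates x n b with n ℕₚ.≟ n
... | yes _   = refl
... | no  n≢n = contradiction refl n≢n

≔-minimal : ∀ x n b {i} → i ≢ n → (x [ n ≔ b ]) i ≡ x i
≔-minimal x n b {i} i≢n with i ℕₚ.≟ n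
... | yes i≡n = contradiction i≡n i≢n
... | no  _   = refl

∈-≔ : ∀ {x y n b} → x n ≡ b → x ∈[ y ↾ n ] → x ∈[ y [ n ≔ b ] ↾ suc n ]
∈-≔ {x} {y} {n} {b} xn≡b p i i<1+n with ℕₚ.m≤n⇒m<n∨m≡n (ℕₚ.≤-pred i<1+n)
... | inj₁ i<n  = trans (p i i<n) (sym (≔-minimal y n b (ℕₚ.<⇒≢ i<n)))
... | inj₂ refl = trans xn≡b (sym (≔-updates y n b))

-- A word of length `n` is represented by any point that extends it.
Covered : List Cantor → ℕ → Pred Cantor 0ℓ
Covered L n x = Any (λ c → x ∈[ c ↾ n ]) L

extensions : ℕ → Cantor → ℕ → List Cantor
extensions zero    c n = [ c ]
extensions (suc k) c n =
  extensions k (c [ n ≔ false ]) (suc n) ++ extensions k (c [ n ≔ true ]) (suc n)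

length-extensions : ∀ k c n → length (extensions k c n) ≡ 2^ k
length-extensions zero    c n = refl
length-extensions (suc k) c n = begin
  length (extensions k _ _ ++ extensions k _ _)            ≡⟨ length-++ (extensions k _ _) ⟩
  length (extensions k _ _) +ℕ length (extensions k _ _)   ≡⟨ cong₂ _+ℕ_ (length-extensions k _ _) (length-extensions k _ _) ⟩
  2^ k +ℕ 2^ k                                             ≡⟨ cong (2^ k +ℕ_) (ℕₚ.+-identityʳ (2^ k)) ⟨
  2^ (suc k)                                               ∎
  where open ≡-Reasoning

extensions-cover : ∀ k {c n x} → x ∈[ c ↾ n ] → Covered (extensions k c n) (n +ℕ k) x
extensions-cover zero {n = n} x∈ rewrite ℕₚ.+-identityʳ n = here x∈
extensions-cover (suc k) {n = n} {x} x∈ rewrite ℕₚ.+-suc n k with x n in xn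
... | false = ++⁺ˡ (extensions-cover k (∈-≔ xn x∈))
... | true  = ++⁺ʳ _ (extensions-cover k (∈-≔ xn x∈))

ZeroOn : ℕ → ℕ → Pred Cantor 0ℓ
ZeroOn n m x = ∀ i → n ≤ℕ i → i <ℕ m → x i ≡ false

-- After the first `true` all bits are free; the zero word is lost in the empty list at the end.
nonzeroExtensions : ℕ → Cantor → ℕ → List Cantor
nonzeroExtensions zero    c n = []
nonzeroExtensions (suc k) c n =
  extensions k (c [ n ≔ true ]) (suc n) ++ nonzeroExtensions k (c [ n ≔ false ]) (suc n)

length-nonzeroExtensions : ∀ k c n → suc (length (nonzeroExtensions k c n)) ≡ 2^ k
length-nonzeroExtensions zero    c n = refl
length-nonzeroExtensions (suc k) c n = begin
  suc (length (extensions k _ _ ++ nonzeroExtensions k _ _))           ≡⟨ cong suc (length-++ (extensions k _ _)) ⟩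
  suc (length (extensions k _ _) +ℕ length (nonzeroExtensions k _ _))  ≡⟨ ℕₚ.+-suc (length (extensions k _ _)) _ ⟨
  length (extensions k _ _) +ℕ suc (length (nonzeroExtensions k _ _))  ≡⟨ cong₂ _+ℕ_ (length-extensions k _ _) (length-nonzeroExtensions k _ _) ⟩
  2^ k +ℕ 2^ k                                                         ≡⟨ cong (2^ k +ℕ_) (ℕₚ.+-identityʳ (2^ k)) ⟨
  2^ (suc k)                                                           ∎
  where open ≡-Reasoning

nonzeroExtensions-cover : ∀ k {c n x} → x ∈[ c ↾ n ] → ¬ ZeroOn n (n +ℕ k) x →
                          Covered (nonzeroExtensions k c n) (n +ℕ k) x
nonzeroExtensions-cover zero {n = n} x∈ ¬0 rewrite ℕₚ.+-identityʳ n =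
  contradiction (λ i n≤i i<n → contradiction n≤i (ℕₚ.<⇒≱ i<n)) ¬0
nonzeroExtensions-cover (suc k) {n = n} {x} x∈ ¬0 rewrite ℕₚ.+-suc n k with x n in xn
... | true  = ++⁺ˡ (extensions-cover k (∈-≔ xn x∈))
... | false = ++⁺ʳ _ (nonzeroExtensions-cover k (∈-≔ xn x∈) λ 0-above →
      ¬0 λ i n≤i i<m → [ (λ n<i → 0-above i n<i i<m) , (λ { refl → xn }) ]′
        (ℕₚ.m≤n⇒m<n∨m≡n n≤i))

-- Sets with small covers by prefixes of one length

-- The cylinders have total measure at most `2^(-e)`, expressed by counting.
HasSmallCover : ℕ → ℕ → Pred Cantor 0ℓ → Set
HasSmallCover e n C =
  ∃[ L ] length L *ℕ 2^ e ≤ℕ 2^ n × (∀ x → x ∈ₚ C → Covered L n x)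

-- Covers are demanded at all large lengths, so that those of several sets can be taken at a common
-- length.
Thin : Pred Cantor 0ℓ → Set
Thin C = ∀ e → ∃[ t ] (∀ n → t ≤ℕ n → HasSmallCover e n C)

-- Each of the two sets is granted half of the measure allowed.
thin-∪ : ∀ {C D} → Thin C → Thin D → Thin (C ∪ₚ D)
thin-∪ {C} {D} thinC thinD e =
  let s , coverC = thinC (suc e) ; t , coverD = thinD (suc e) in
  s ⊔ t , λ n s⊔t≤n →
    let L , L≤ , L-covers = coverC n (ℕₚ.≤-trans (ℕₚ.m≤m⊔n s t) s⊔t≤n)
        M , M≤ , M-covers = coverD n (ℕₚ.≤-trans (ℕₚ.m≤n⊔m s t) s⊔t≤n)
    in L ++ M , measure L M n L≤ M≤ , λ where
         x (inj₁ x∈C) → ++⁺ˡ (L-covers x x∈C)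
         x (inj₂ x∈D) → ++⁺ʳ L (M-covers x x∈D)
  where
  open ℕₚ.≤-Reasoning
  measure : ∀ (L M : List Cantor) n → length L *ℕ 2^ (suc e) ≤ℕ 2^ n → length M *ℕ 2^ (suc e) ≤ℕ 2^ n →
         length (L ++ M) *ℕ 2^ e ≤ℕ 2^ n
  measure L M n L≤ M≤ = ℕₚ.*-cancelˡ-≤ 2 (begin
    2 *ℕ (length (L ++ M) *ℕ 2^ e)              ≡⟨ cong (λ l → 2 *ℕ (l *ℕ 2^ e)) (length-++ L) ⟩
    2 *ℕ ((length L +ℕ length M) *ℕ 2^ e)       ≡⟨ ℕₚ.*-assoc 2 (length L +ℕ length M) (2^ e) ⟨
    2 *ℕ (length L +ℕ length M) *ℕ 2^ e         ≡⟨ cong (_*ℕ 2^ e) (ℕₚ.*-comm 2 (length L +ℕ length M)) ⟩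
    (length L +ℕ length M) *ℕ 2 *ℕ 2^ e         ≡⟨ ℕₚ.*-assoc (length L +ℕ length M) 2 (2^ e) ⟩
    (length L +ℕ length M) *ℕ 2^ (suc e)        ≡⟨ ℕₚ.*-distribʳ-+ (2^ (suc e)) (length L) (length M) ⟩
    length L *ℕ 2^ (suc e) +ℕ length M *ℕ 2^ (suc e) ≤⟨ ℕₚ.+-mono-≤ L≤ M≤ ⟩
    2^ n +ℕ 2^ n                                ≡⟨ cong (2^ n +ℕ_) (ℕₚ.+-identityʳ (2^ n)) ⟨
    2 *ℕ 2^ n                                   ∎)

upTo : (ℕ → Pred Cantor 0ℓ) → ℕ → Pred Cantor 0ℓ
upTo C n x = ∃[ i ] i ≤ℕ n × x ∈ₚ C i

thin-⊆ : ∀ {C D : Pred Cantor 0ℓ} → (∀ x → x ∈ₚ C → x ∈ₚ D) → Thin D → Thin C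
thin-⊆ C⊆D thinD e = let t , cover = thinD e in t , λ n t≤n →
  let L , L≤ , L-covers = cover n t≤n in L , L≤ , λ x x∈C → L-covers x (C⊆D x x∈C)

thin-upTo : ∀ {C} → (∀ i → Thin (C i)) → ∀ n → Thin (upTo C n)
thin-upTo {C} thin zero    = thin-⊆ (λ { x (zero , _ , x∈C) → x∈C }) (thin 0)
thin-upTo {C} thin (suc n) = thin-⊆ split (thin-∪ (thin-upTo thin n) (thin (suc n)))
  where
  split : ∀ x → x ∈ₚ upTo C (suc n) → (upTo C n ∪ₚ C (suc n)) x
  split x (i , i≤1+n , x∈C) with ℕₚ.m≤n⇒m<n∨m≡n i≤1+n
  ... | inj₁ i≤n  = inj₁ (i , ℕₚ.≤-pred i≤n , x∈C)
  ... | inj₂ refl = inj₂ x∈C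

-- A finite cover becomes a sequence by appending cylinders of total measure 2^(-e).
centre : List Cantor → ℕ → Cantor
centre []      i       = λ _ → false
centre (c ∷ L) zero    = c
centre (c ∷ L) (suc i) = centre L i

depth : ℕ → ℕ → List Cantor → ℕ → ℕ
depth n e []      i       = suc e +ℕ i
depth n e (c ∷ L) zero    = n
depth n e (c ∷ L) (suc i) = depth n e L i

∑-depth : ∀ n e L N → ∑ (λ i → ½^ (depth n e L i)) N ≤ ι (length L) * ½^ n + ½^ e
∑-depth n e [] N = begin
  ∑ (λ i → ½^ (suc e +ℕ i)) N   ≤⟨ ∑-½^≤ e N ⟩
  ½^ e                          ≡⟨ ℚₚ.+-identityˡ (½^ e) ⟨
  0ℚ + ½^ e                     ≡⟨ cong (_+ ½^ e) (ℚₚ.*-zeroˡ (½^ n)) ⟨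
  0ℚ * ½^ n + ½^ e              ∎
  where open ℚₚ.≤-Reasoning
∑-depth n e L@(_ ∷ _) zero = ℚₚ.+-mono-≤ 0≤ (½^≥0 e)
  where
  0≤ : 0ℚ ≤ ι (length L) * ½^ n
  0≤ = ℚₚ.≤-trans (ℚₚ.≤-reflexive (sym (ℚₚ.*-zeroˡ (½^ n))))
         (ℚₚ.*-monoʳ-≤-nonNeg (½^ n) {{½^-nonNegative n}} (0≤ι (length L)))
∑-depth n e (c ∷ L) (suc N) = begin
  ∑ (λ i → ½^ (depth n e (c ∷ L) i)) (suc N)         ≡⟨ ∑-cons _ N ⟩
  ½^ n + ∑ (λ i → ½^ (depth n e L i)) N              ≤⟨ ℚₚ.+-monoʳ-≤ (½^ n) (∑-depth n e L N) ⟩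
  ½^ n + (ι (length L) * ½^ n + ½^ e)                ≡⟨ ℚₚ.+-assoc (½^ n) _ _ ⟨
  ½^ n + ι (length L) * ½^ n + ½^ e                  ≡⟨ cong (λ p → p + ι (length L) * ½^ n + ½^ e) (ℚₚ.*-identityˡ (½^ n)) ⟨
  1ℚ * ½^ n + ι (length L) * ½^ n + ½^ e             ≡⟨ cong (_+ ½^ e) (ℚₚ.*-distribʳ-+ (½^ n) 1ℚ (ι (length L))) ⟨
  ι (suc (length L)) * ½^ n + ½^ e                   ∎
  where open ℚₚ.≤-Reasoning

centre-cover : ∀ {n e x} L → Covered L n x → ∃[ i ] x ∈[ centre L i ↾ depth n e L i ]
centre-cover (c ∷ L) (here x∈)  = 0 , x∈
centre-cover (c ∷ L) (there x∈) = let i , x∈′ = centre-cover L x∈ in suc i , x∈′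

-- Half of `½^ e` pays for the finite cover, the other half for the cylinders that pad it to a
-- sequence.
small-covers⇒null : ∀ {C} → (∀ e → ∃[ n ] HasSmallCover e n C) → Null C
small-covers⇒null {C} small ε 0<ε =
  let e , ½ᵉ≤ε = ½^-small ε 0<ε
      n , L , L≤ , L-covers = small (suc e)
  in centre L , depth n (suc e) L
   , (λ x x∈C → centre-cover L (L-covers x x∈C))
   , λ N → begin
       ∑ (λ i → ½^ (depth n (suc e) L i)) N   ≤⟨ ∑-depth n (suc e) L N ⟩
       ι (length L) * ½^ n + ½^ (suc e)       ≤⟨ ℚₚ.+-monoˡ-≤ (½^ (suc e)) (ℕ⇒density (length L) n (suc e) L≤) ⟩
       ½^ (suc e) + ½^ (suc e)                ≡⟨ ½^-double e ⟩
       ½^ e                                   ≤⟨ ½ᵉ≤ε ⟩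
       ε                                      ∎
  where open ℚₚ.≤-Reasoning

module _ (c : ℕ → Cantor) (k : ℕ → ℕ) where

  prefixes : ℕ → ℕ → List Cantor
  prefixes n zero    = []
  prefixes n (suc N) = prefixes n N ++ extensions (n ∸ℕ k N) (c N) (k N)

  maxDepth : ℕ → ℕ
  maxDepth zero    = 0
  maxDepth (suc N) = maxDepth N ⊔ k N

  -- Refining a cylinder to length `n` preserves its measure: `2^ (n ∸ℕ k N)` pieces of measure
  -- `½^ n` make up `½^ (k N)`.
  prefixes-density : ∀ n N → maxDepth N ≤ℕ n →
                     ι (length (prefixes n N)) * ½^ n ≡ ∑ (λ i → ½^ (k i)) N
  prefixes-density n zero    _  = ℚₚ.*-zeroˡ (½^ n)
  prefixes-density n (suc N) ≤n = begin
    ι (length (prefixes n N ++ L)) * ½^ n               ≡⟨ cong (λ l → ι l * ½^ n) (length-++ (prefixes n N)) ⟩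
    ι (length (prefixes n N) +ℕ length L) * ½^ n        ≡⟨ cong (_* ½^ n) (ι-homo-+ (length (prefixes n N)) (length L)) ⟩
    (ι (length (prefixes n N)) + ι (length L)) * ½^ n   ≡⟨ ℚₚ.*-distribʳ-+ (½^ n) (ι (length (prefixes n N))) (ι (length L)) ⟩
    ι (length (prefixes n N)) * ½^ n + ι (length L) * ½^ n
      ≡⟨ cong₂ _+_ (prefixes-density n N (ℕₚ.≤-trans (ℕₚ.m≤m⊔n _ _) ≤n))
          (trans (cong (λ l → ι l * ½^ n) (length-extensions (n ∸ℕ k N) (c N) (k N)))
            (ι2^∸*½^ (ℕₚ.≤-trans (ℕₚ.m≤n⊔m (maxDepth N) _) ≤n))) ⟩
    ∑ (λ i → ½^ (k i)) N + ½^ (k N)                     ∎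
    where
    open ≡-Reasoning
    L = extensions (n ∸ℕ k N) (c N) (k N)

  prefixes-cover : ∀ n N → maxDepth N ≤ℕ n → ∀ {x i} → i <ℕ N → x ∈[ c i ↾ k i ] →
                   Covered (prefixes n N) n x
  prefixes-cover n (suc N) ≤n {x} {i} i<1+N x∈ with ℕₚ.m≤n⇒m<n∨m≡n (ℕₚ.≤-pred i<1+N)
  ... | inj₁ i<N  = ++⁺ˡ (prefixes-cover n N (ℕₚ.≤-trans (ℕₚ.m≤m⊔n _ _) ≤n) i<N x∈)
  ... | inj₂ refl = ++⁺ʳ (prefixes n N)
    (subst (λ m → Covered (extensions (n ∸ℕ k N) (c N) (k N)) m x)
      (ℕₚ.m+[n∸m]≡n (ℕₚ.≤-trans (ℕₚ.m≤n⊔m (maxDepth N) _) ≤n))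
      (extensions-cover (n ∸ℕ k N) x∈))

-- Words as elements of finite types, and blocks of coordinates

funToFin-cong : ∀ {m n} {f g : Fin m → Fin n} → f ≗ g → funToFin f ≡ funToFin g
funToFin-cong {zero}  f≗g = refl
funToFin-cong {suc m} f≗g = cong₂ Fin.combine (f≗g Fin.zero) (funToFin-cong (f≗g ∘ Fin.suc))

open Inverse Finₚ.2↔Bool using () renaming (to to bool; from to bit; strictlyInverseˡ to bool-bit; strictlyInverseʳ to bit-bool)

word : ∀ n k → Cantor → Fin (2^ k)
word n k x = funToFin {k} (λ i → bit (x (n +ℕ toℕ i)))

word-cong : ∀ n k {x y} → (∀ i → n ≤ℕ i → i <ℕ n +ℕ k → x i ≡ y i) → word n k x ≡ word n k y
word-cong n k x≡y = funToFin-cong {k} λ i →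
  cong bit (x≡y (n +ℕ toℕ i) (ℕₚ.m≤m+n n (toℕ i)) (ℕₚ.+-monoʳ-< n (Finₚ.toℕ<n i)))

word-injective : ∀ n k {x y} → word n k x ≡ word n k y → ∀ i → n ≤ℕ i → i <ℕ n +ℕ k → x i ≡ y i
word-injective n k {x} {y} wx≡wy i n≤i i<n+k = begin
  x i                          ≡⟨ cong x n+j≡i ⟨
  x (n +ℕ toℕ j)               ≡⟨ bool-bit _ ⟨
  bool (bit (x (n +ℕ toℕ j)))  ≡⟨ cong bool (Finₚ.finToFun-funToFin {k} _ j) ⟨
  bool (finToFun (word n k x) j) ≡⟨ cong (λ w → bool (finToFun {m = 2} {n = k} w j)) wx≡wy ⟩
  bool (finToFun (word n k y) j) ≡⟨ cong bool (Finₚ.finToFun-funToFin {k} _ j) ⟩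
  bool (bit (y (n +ℕ toℕ j)))  ≡⟨ bool-bit _ ⟩
  y (n +ℕ toℕ j)               ≡⟨ cong y n+j≡i ⟩
  y i                          ∎
  where
  open ≡-Reasoning
  i∸n<k : i ∸ℕ n <ℕ k
  i∸n<k = ℕₚ.+-cancelˡ-< n _ _ (subst (_<ℕ n +ℕ k) (sym (ℕₚ.m+[n∸m]≡n n≤i)) i<n+k)
  j = fromℕ< i∸n<k
  n+j≡i : n +ℕ toℕ j ≡ i
  n+j≡i = trans (cong (n +ℕ_) (Finₚ.toℕ-fromℕ< i∸n<k)) (ℕₚ.m+[n∸m]≡n n≤i)

offset : (ℕ → ℕ) → ℕ → ℕ
offset p zero    = 0
offset p (suc t) = offset p t +ℕ p t

offset-mono : ∀ p {s t} → s ≤ℕ t → offset p s ≤ℕ offset p t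
offset-mono p {s} {zero}  z≤n = ℕₚ.≤-refl
offset-mono p {s} {suc t} s≤1+t with ℕₚ.m≤n⇒m<n∨m≡n s≤1+t
... | inj₁ s≤t  = ℕₚ.≤-trans (offset-mono p (ℕₚ.≤-pred s≤t)) (ℕₚ.m≤m+n _ _)
... | inj₂ refl = ℕₚ.≤-refl

Position : (ℕ → ℕ) → ℕ → Set
Position p i = Σ[ t ∈ ℕ ] Σ[ j ∈ Fin (p t) ] i ≡ offset p t +ℕ toℕ j

private
  offset-disjoint : ∀ p {s t} (i : Fin (p s)) (j : ℕ) → s <ℕ t →
                   offset p s +ℕ toℕ i ≢ offset p t +ℕ j
  offset-disjoint p {s} {t} i j s<t eq = ℕₚ.<-irrefl eq (begin-strict
    offset p s +ℕ toℕ i  <⟨ ℕₚ.+-monoʳ-< (offset p s) (Finₚ.toℕ<n i) ⟩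
    offset p (suc s)     ≤⟨ offset-mono p s<t ⟩
    offset p t           ≤⟨ ℕₚ.m≤m+n _ j ⟩
    offset p t +ℕ j      ∎)
    where open ℕₚ.≤-Reasoning

Words : (ℕ → ℕ) → Set
Words p = ∀ t → Fin (2^ (p t))

private
  -- Coordinates in no block get the default `false`. The decision is an argument so that proofs can
  -- match on it.
  digit : ∀ p {i} → Words p → Dec (Position p i) → Bool
  digit p w (yes (t , j , _)) = bool (finToFun {n = p t} (w t) j)
  digit p w (no _)            = false

  -- Blocks are disjoint, so whatever position the decision supplies must be `t` and `j`.
  digit-correct : ∀ p (w : Words p) t (j : Fin (p t))
                  (d : Dec (Position p (offset p t +ℕ toℕ j))) →
                  digit p w d ≡ bool (finToFun {n = p t} (w t) j)
  digit-correct p w t j (no none) = contradiction (t , j , refl) none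
  digit-correct p w t j (yes (s , i , eq)) with ℕₚ.<-cmp s t
  ... | tri< s<t _ _ = contradiction (sym eq) (offset-disjoint p i (toℕ j) s<t)
  ... | tri> _ _ t<s = contradiction eq (offset-disjoint p j (toℕ i) t<s)
  ... | tri≈ _ refl _ with Finₚ.toℕ-injective (ℕₚ.+-cancelˡ-≡ (offset p t) (toℕ j) (toℕ i) eq)
  ...   | refl = refl

-- Finite subsets of prescribed size

insert-size : ∀ {n} (x : Fin n) (S : Subset n) → ∣ ⁅ x ⁆ ∪ S ∣ ≤ℕ suc ∣ S ∣
insert-size Fin.zero    (s ∷ S) rewrite Subₚ.∪-identityˡ S = s≤s (Subₚ.∣p∣≤∣x∷p∣ s S)
insert-size (Fin.suc x) (inside  ∷ S) = s≤s (insert-size x S)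
insert-size (Fin.suc x) (outside ∷ S) = insert-size x S

image-subset : ∀ {m n} (g : Fin m → Fin n) (S : Subset m) →
               Σ[ T ∈ Subset n ] ∣ T ∣ ≤ℕ ∣ S ∣ × (∀ {v} → v ∈ S → g v ∈ T)
image-subset {n = n} g [] = ∅ , ℕₚ.≤-reflexive (Subₚ.∣⊥∣≡0 n) , λ ()
image-subset g (outside ∷ S) = let T , T≤ , gS⊆T = image-subset (g ∘ Fin.suc) S in
  T , T≤ , λ { (there v∈S) → gS⊆T v∈S }
image-subset g (inside ∷ S) = let T , T≤ , gS⊆T = image-subset (g ∘ Fin.suc) S in
  ⁅ g Fin.zero ⁆ ∪ T , ℕₚ.≤-trans (insert-size (g Fin.zero) T) (s≤s T≤) , λ where
    here         → Subₚ.x∈p∪q⁺ (inj₁ (Subₚ.x∈⁅x⁆ (g Fin.zero)))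
    (there v∈S)   → Subₚ.x∈p∪q⁺ (inj₂ (gS⊆T v∈S))

-- Slaloms ask for an exact size, whereas images and covers only come with upper bounds.
enlarge : ∀ {n} (S : Subset n) m → ∣ S ∣ ≤ℕ m → m ≤ℕ n →
          Σ[ T ∈ Subset n ] ∣ T ∣ ≡ m × S ⊆ₛ T
enlarge []            zero    _         _         = [] , refl , id
enlarge (inside  ∷ S) (suc m) (s≤s S≤m) (s≤s m≤n) =
  let T , ∣T∣≡m , S⊆T = enlarge S m S≤m m≤n in
  inside ∷ T , cong suc ∣T∣≡m , Subₚ.s⊆s S⊆T
enlarge {suc n} (outside ∷ S) m S≤m m≤1+n with ℕₚ.m≤n⇒m<n∨m≡n m≤1+n
... | inj₁ m<1+n = let T , ∣T∣≡m , S⊆T = enlarge S m S≤m (ℕₚ.≤-pred m<1+n) in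
  outside ∷ T , ∣T∣≡m , Subₚ.s⊆s S⊆T
... | inj₂ refl  = ⊤ , Subₚ.∣⊤∣≡n (suc n) , λ _ → Subₚ.∈⊤

list⇒subset : ∀ {n} {A : Set} (f : A → Fin n) (L : List A) m → length L ≤ℕ m → m ≤ℕ n →
              Σ[ T ∈ Subset n ] ∣ T ∣ ≡ m × (∀ {v} → Any (λ a → v ≡ f a) L → v ∈ T)
list⇒subset f L m L≤m m≤n =
  let T , T≤ , f⊆T = image-subset (f ∘ lookup L) ⊤
      U , ∣U∣≡m , T⊆U = enlarge T m (ℕₚ.≤-trans T≤
        (ℕₚ.≤-trans (ℕₚ.≤-reflexive (Subₚ.∣⊤∣≡n (length L))) L≤m)) m≤n
  in U , ∣U∣≡m , λ v∈L → subst (_∈ U) (sym (lookup-index′ v∈L)) (T⊆U (f⊆T Subₚ.∈⊤))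
  where
  lookup-index′ : ∀ {v} (p : Any (λ a → v ≡ f a) L) → v ≡ f (lookup L (Any.index p))
  lookup-index′ = lookup-index

-- Compactness of the Cantor space

module Topology (em : Classical) where
  open Logic em

  -- By contradiction, as in König's lemma: a bad node has a bad child, and the branch so obtained
  -- would meet a good node.
  fan : (Good : Cantor → ℕ → Set) →
        (∀ {x y n} → x ∈[ y ↾ n ] → Good x n → Good y n) →
        (∀ {x n} → (∀ b → Good (x [ n ≔ b ]) (suc n)) → Good x n) →
        (∀ x → ∃[ n ] Good x n) → ∀ x → Good x 0
  fan Good respects bar-inductive bar x = by-contradiction λ bad →
    let n , good = bar (branch bad)
    in proj₂ (nodes bad n) (respects (branch-∈ bad n) good)
    where
    child : ∀ {n} → (∃[ y ] ¬ Good y n) → ∃[ y ] ¬ Good y (suc n)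
    child {n} (y , bad) = let b , bad′ = ¬∀⇒∃¬ (bad ∘ bar-inductive) in y [ n ≔ b ] , bad′
    module _ (bad : ¬ Good x 0) where
      nodes : ∀ n → ∃[ y ] ¬ Good y n
      nodes zero    = x , bad
      nodes (suc n) = child (nodes n)
      branch : Cantor
      branch n = proj₁ (nodes (suc n)) n
      branch-∈ : ∀ n → branch ∈[ proj₁ (nodes n) ↾ n ]
      branch-∈ (suc n) i i<1+n with ℕₚ.m≤n⇒m<n∨m≡n (ℕₚ.≤-pred i<1+n)
      ... | inj₁ i<n  = trans (branch-∈ n i i<n) (sym (≔-minimal (proj₁ (nodes n)) n _ (ℕₚ.<⇒≢ i<n)))
      ... | inj₂ refl = refl

  -- `fan` is applied to the statement that finitely many of the cylinders cover `C` inside a given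
  -- cylinder; two halves are merged by taking the larger bound.
  compact : ∀ {C} → Closed C → ∀ (c : ℕ → Cantor) (k : ℕ → ℕ) →
            (∀ x → x ∈ₚ C → ∃[ i ] x ∈[ c i ↾ k i ]) →
            ∃[ N ] (∀ x → x ∈ₚ C → ∃[ i ] i <ℕ N × x ∈[ c i ↾ k i ])
  compact {C} closed c k cover =
    let N , good = fan Good respects merge bar (λ _ → false) in N , λ x → good x λ _ ()
    where
    Good : Cantor → ℕ → Set
    Good x n = ∃[ N ] (∀ y → y ∈[ x ↾ n ] → y ∈ₚ C → ∃[ i ] i <ℕ N × y ∈[ c i ↾ k i ])
    respects : ∀ {x y n} → x ∈[ y ↾ n ] → Good x n → Good y n
    respects x∈ (N , good) = N , λ z z∈ → good z (∈-trans z∈ (∈-sym x∈))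
    merge : ∀ {x n} → (∀ b → Good (x [ n ≔ b ]) (suc n)) → Good x n
    merge {x} {n} good = proj₁ (good false) ⊔ proj₁ (good true) , λ y y∈ y∈C →
      let i , i< , y∈cᵢ = proj₂ (good (y n)) y (∈-≔ refl y∈) y∈C in
      i , ℕₚ.<-≤-trans i< (bound (y n)) , y∈cᵢ
      where
      bound : ∀ b → proj₁ (good b) ≤ℕ proj₁ (good false) ⊔ proj₁ (good true)
      bound false = ℕₚ.m≤m⊔n _ _
      bound true  = ℕₚ.m≤n⊔m (proj₁ (good false)) _
    bar : ∀ x → ∃[ n ] Good x n
    bar x with lem {P = x ∈ₚ C}
    ... | yes x∈C = let i , x∈ = cover x x∈C in
          k i , suc i , λ y y∈ _ → i , ℕₚ.n<1+n i , ∈-trans y∈ x∈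
    -- A cylinder disjoint from `C` is handled by the empty subfamily.
    ... | no  x∉C = let n , disjoint = closed x x∉C in
          n , 0 , λ y y∈ y∈C → contradiction y∈C (disjoint y y∈)

  -- Finitely many cylinders of the cover suffice, and beyond their greatest depth they can be
  -- refined to any common length.
  closed-null⇒thin : ∀ {C} → Closed C → Null C → Thin C
  closed-null⇒thin closed null e =
    let c , k , cover , ∑≤ = null (½^ e) (ℚₚ.positive⁻¹ (½^ e) {{½^-positive e}})
        N , cover-N = compact closed c k cover
    in maxDepth c k N , λ n ≤n →
       prefixes c k n N
       , density⇒ℕ (length (prefixes c k n N)) n e
           (ℚₚ.≤-trans (ℚₚ.≤-reflexive (prefixes-density c k n N ≤n)) (∑≤ N))
       , λ x x∈C → let i , i<N , x∈ = cover-N x x∈C in prefixes-cover c k n N ≤n i<N x∈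

  glue : ∀ p → Words p → Cantor
  glue p w i = digit p {i} w lem

  word-glue : ∀ p (w : Words p) t → word (offset p t) (p t) (glue p w) ≡ w t
  word-glue p w t = begin
    word (offset p t) (p t) (glue p w)                        ≡⟨ funToFin-cong {p t} (λ j → cong bit (digit-correct p w t j lem)) ⟩
    funToFin {p t} (λ j → bit (bool (finToFun (w t) j)))      ≡⟨ funToFin-cong {p t} (λ j → bit-bool _) ⟩
    funToFin {p t} (finToFun (w t))                           ≡⟨ Finₚ.funToFin-finToFin {m = p t} (w t) ⟩
    w t                                                       ∎
    where open ≡-Reasoning

  -- Pigeonhole: the image of `S` has at most `∣ S ∣` elements.
  avoid : ∀ {m n} (g : Fin m → Fin n) (S : Subset m) → ∣ S ∣ <ℕ n →
          ∃[ a ] (∀ {v} → v ∈ S → g v ≢ a)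
  avoid {n = n} g S S<n with image-subset g S
  ... | T , T≤S , gS⊆T = let a , a∉T = ¬∀⇒∃¬ T≢⊤ in a , λ v∈S gv≡a → a∉T (subst (_∈ T) gv≡a (gS⊆T v∈S))
    where
    T≢⊤ : ¬ (∀ a → a ∈ T)
    T≢⊤ all = ℕₚ.<⇒≱ (ℕₚ.≤-<-trans T≤S S<n)
      (subst (_≤ℕ ∣ T ∣) (Subₚ.∣⊤∣≡n n) (Subₚ.p⊆q⇒∣p∣≤∣q∣ {p = ⊤} λ {a} _ → all a))

-- Summable slaloms from members of ℰ

-- Enumerates the pairs along antidiagonals, each from `(s , 0)` to `(0 , s)`.
nextPair : ℕ × ℕ → ℕ × ℕ
nextPair (zero  , n) = suc n , 0
nextPair (suc m , n) = m , suc n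

unpair : ℕ → ℕ × ℕ
unpair zero    = 0 , 0
unpair (suc n) = nextPair (unpair n)

unpair-surjective : ∀ s m n → m +ℕ n ≡ s → ∃[ i ] unpair i ≡ (m , n)
unpair-surjective zero    zero    zero    _ = 0 , refl
unpair-surjective s       m       (suc n) p =
  let i , eq = unpair-surjective s (suc m) n (trans (sym (ℕₚ.+-suc m n)) p)
  in suc i , cong nextPair eq
unpair-surjective (suc s) (suc m) zero    p =
  let i , eq = unpair-surjective s zero m (trans (sym (ℕₚ.+-identityʳ m)) (ℕₚ.suc-injective p))
  in suc i , cong nextPair eq

-- The factor `N - 1` is written additively to avoid truncated subtraction.
concatMap-length : ∀ {A B : Set} (f : A → List B) N → (∀ a → suc (length (f a)) ≡ N) →
                   ∀ L → length (concatMap f L) +ℕ length L ≡ length L *ℕ N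
concatMap-length f N fN []      = refl
concatMap-length f N fN (a ∷ L) = begin
  length (f a ++ concatMap f L) +ℕ suc (length L)             ≡⟨ cong (_+ℕ suc (length L)) (length-++ (f a)) ⟩
  length (f a) +ℕ length (concatMap f L) +ℕ suc (length L)    ≡⟨ ℕₚ.+-suc _ (length L) ⟩
  suc (length (f a) +ℕ length (concatMap f L) +ℕ length L)    ≡⟨ cong suc (ℕₚ.+-assoc (length (f a)) _ _) ⟩
  suc (length (f a)) +ℕ (length (concatMap f L) +ℕ length L)  ≡⟨ cong₂ _+ℕ_ (fN a) (concatMap-length f N fN L) ⟩
  N +ℕ length L *ℕ N                                          ∎
  where open ≡-Reasoning

2^-mono-≤ : ∀ {m n} → m ≤ℕ n → 2^ m ≤ℕ 2^ n
2^-mono-≤ = ℕₚ.^-monoʳ-≤ 2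

2^-mono-< : ∀ {m n} → m <ℕ n → 2^ m <ℕ 2^ n
2^-mono-< = ℕₚ.^-monoʳ-< 2 (s≤s (s≤s z≤n))

log₂ : ∀ t → ∃[ k ] 2^ k ≤ℕ suc t × suc t <ℕ 2^ (suc k)
log₂ zero = 0 , ℕₚ.≤-refl , ℕₚ.≤-refl
log₂ (suc t) with log₂ t
... | k , lower , upper with ℕₚ.m≤n⇒m<n∨m≡n upper
...   | inj₁ t+2<2ᵏ⁺¹ = k , ℕₚ.m≤n⇒m≤1+n lower , t+2<2ᵏ⁺¹
...   | inj₂ t+2≡2ᵏ⁺¹ = suc k , ℕₚ.≤-reflexive (sym t+2≡2ᵏ⁺¹)
      , subst (_<ℕ 2^ (suc (suc k))) (sym t+2≡2ᵏ⁺¹) (2^-mono-< (ℕₚ.n<1+n (suc k)))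

xor-cancelˡ : ∀ a b → a xor (a xor b) ≡ b
xor-cancelˡ a b = trans (sym (xor-assoc a a b))
  (trans (cong (_xor b) (xor-same a)) (xor-identityˡ b))

xor≡false⇒≡ : ∀ a b → a xor b ≡ false → a ≡ b
xor≡false⇒≡ true  true  _ = refl
xor≡false⇒≡ false false _ = refl

module Summables (em : Classical) (ac : AxiomOfChoice) where
  open Logic em
  open Choice ac
  open Topology em

  -- Induction on the generation of the ideal; a union of countably many sequences is reindexed
  -- through `unpair`.
  ℰ⇒thin : ∀ {E} → ℰ E →
           Σ[ C ∈ (ℕ → Pred Cantor 0ℓ) ] (∀ i → Thin (C i)) × (∀ x → x ∈ₚ E → ∃[ i ] x ∈ₚ C i)
  ℰ⇒thin (closedNull {C} closed null) =
    (λ _ → C) , (λ _ → closed-null⇒thin closed null) , λ x x∈ → 0 , x∈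
  ℰ⇒thin (subset-∈ A⊆B ℰB) = let C , thin , cover = ℰ⇒thin ℰB in
    C , thin , λ x x∈A → cover x (A⊆B x∈A)
  ℰ⇒thin (union-∈ {A} ℰA) =
    (λ i → let m , n = unpair i in proj₁ (ih m) n)
    , (λ i → let m , n = unpair i in proj₁ (proj₂ (ih m)) n)
    , λ { x (m , x∈Aₘ) →
          let n , x∈C = proj₂ (proj₂ (ih m)) x x∈Aₘ
              i , eq = unpair-surjective (m +ℕ n) m n refl
          in i , subst (λ (m , n) → x ∈ₚ proj₁ (ih m) n) (sym eq) x∈C }
    where
    ih : ∀ m → _
    ih m = ℰ⇒thin (ℰA m)

  module _ {C : ℕ → Pred Cantor 0ℓ} (thin : ∀ i → Thin (C i)) where

    private
      threshold : ℕ → ℕ → ℕ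
      threshold k e = proj₁ (thin-upTo thin k e)

    -- The k-th interval has length q k + (k + 1) and begins at s k; q k is so
    -- large that the part of C 0 ∪ … ∪ C k seen there has at most 2^(q k)
    -- elements.
    q s : ℕ → ℕ
    q zero    = threshold 0 1
    q (suc k) = suc (q k) +ℕ threshold (suc k) (s (suc k) +ℕ suc (suc k))
    s zero    = 0
    s (suc k) = s k +ℕ (q k +ℕ suc k)

    p : ℕ → ℕ
    p k = q k +ℕ suc k

    s≡offset : ∀ k → s k ≡ offset p k
    s≡offset zero    = refl
    s≡offset (suc k) = cong (_+ℕ p k) (s≡offset k)

    q<q+1 : ∀ k → q k <ℕ q (suc k)
    q<q+1 k = ℕₚ.m≤m+n (suc (q k)) _

    threshold≤q : ∀ k → threshold k (s k +ℕ suc k) ≤ℕ q k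
    threshold≤q zero    = ℕₚ.≤-refl
    threshold≤q (suc k) = ℕₚ.m≤n+m _ (suc (q k))

    -- A cover of measure `2^(-(s k + k + 1))` by words of length `s k + q k + k + 1` has at most
    -- `2^ (q k)` members. The `s k` in the exponent compensates for the coordinates before the
    -- interval.
    interval-cover : ∀ k → ∃[ L ] length L ≤ℕ 2^ (q k) ×
                     (∀ x → x ∈ₚ upTo C k → Covered L (offset p k +ℕ p k) x)
    interval-cover k =
      let L , L≤ , L-covers = proj₂ (thin-upTo thin k (s k +ℕ suc k)) (s k +ℕ p k)
            (ℕₚ.≤-trans (threshold≤q k)
              (ℕₚ.≤-trans (ℕₚ.m≤m+n (q k) (suc k)) (ℕₚ.m≤n+m (p k) (s k))))
      in L
         , ℕₚ.*-cancelʳ-≤ (length L) (2^ (q k)) (2^ (s k +ℕ suc k)) {{ℕₚ.m^n≢0 2 (s k +ℕ suc k)}}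
             (ℕₚ.≤-trans L≤ (ℕₚ.≤-reflexive (2^-split (s k) (q k) (suc k))))
         , subst (λ o → ∀ x → x ∈ₚ upTo C k → Covered L (o +ℕ p k) x) (s≡offset k) L-covers
      where
      2^-split : ∀ a b c → 2^ (a +ℕ (b +ℕ c)) ≡ 2^ b *ℕ 2^ (a +ℕ c)
      2^-split a b c = trans (cong 2^_ (trans (sym (ℕₚ.+-assoc a b c))
        (trans (cong (_+ℕ c) (ℕₚ.+-comm a b)) (ℕₚ.+-assoc b a c)))) (ℕₚ.^-distribˡ-+-* 2 b (a +ℕ c))

    F b : ℕ → ℕ
    F k = 2^ (p k)
    b k = 2^ (q k)

    admissible : Admissible F b
    admissible = record
      { F-increasing = λ k → 2^-mono-< (ℕₚ.+-mono-< (q<q+1 k) (ℕₚ.n<1+n (suc k)))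
      ; b-increasing = λ k → 2^-mono-< (q<q+1 k)
      ; F≥1          = λ k → ℕₚ.m^n>0 2 (p k)
      ; b≤F          = b≤F
      }
      where
      b≤F : ∀ k → b k ≤ℕ F k
      b≤F k = 2^-mono-≤ (ℕₚ.m≤m+n (q k) (suc k))

    -- The `k`-th ratio is `½^ (suc k)`, so the partial sums are those of a geometric series bounded
    -- by 1.
    summable : Summable admissible
    summable = 1ℚ , λ N → ℚₚ.≤-trans
      (ℚₚ.≤-reflexive (∑-cong (λ k → /≡½^ (b k) (F k) (suc k)
        {{ℕ.>-nonZero (Admissible.F≥1 admissible k)}} (sym (ℕₚ.^-distribˡ-+-* 2 (q k) (suc k)))) N))
      (∑-½^≤ 0 N)

    slalom : Cantor → Slm F b
    slalom x = record
      { at   = λ k → proj₁ (covering k)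
      ; size = λ k → proj₁ (proj₂ (covering k))
      }
      where
      covering : ∀ k → _
      covering k = list⇒subset (λ c → word (offset p k) (p k) (x ⊕ c)) (proj₁ (interval-cover k)) (b k)
        (proj₁ (proj₂ (interval-cover k))) (Admissible.b≤F admissible k)

    -- The point `e` shares its prefix with some `c` in the cover, so `z` and `x ⊕ c` have the same
    -- trace on the interval.
    word∈slalom : ∀ {x e z} k → e ∈ₚ upTo C k → z ≐ x ⊕ e →
                  word (offset p k) (p k) z ∈ at (slalom x) k
    word∈slalom {x} {e} {z} k e∈ z≐x⊕e =
      let L , L≤ , L-covers = interval-cover k in
      proj₂ (proj₂ (list⇒subset (λ c → word (offset p k) (p k) (x ⊕ c)) L (b k) L≤ (Admissible.b≤F admissible k)))
        (Any.map (λ e∈[c] → word-cong (offset p k) (p k) λ i _ i< →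
            trans (z≐x⊕e i) (cong (x i xor_) (e∈[c] i i<)))
          (L-covers e e∈))

    slalomFunc : Func 2^ω (SlmSet F b)
    slalomFunc = respectful slalom

    dominating : ∀ {X E} → (∀ x → x ∈ₚ E → ∃[ i ] x ∈ₚ C i) → (∀ z → z ∈ₚ X ⊞ E) →
                 Dominating F b (image {2^ω} {SlmSet F b} (Func.to slalomFunc) X)
    dominating {X} {E} E⊆C X⊞E y =
      let z = glue p y
          x , e , x∈X , e∈E , z≐x⊕e = X⊞E z
          i , e∈Cᵢ = E⊆C e e∈E
          r , r≐ , _ = canonical 2^ω
      -- The point glued from `y` is `x ⊕ e` with `e` in `C i`, and `e` lies in `upTo C n` from
      -- `n = i` on. The slalom is that of the representative `r x`, pointwise equal to `x`.
      in slalom (r x) , (x , x∈X , λ _ → refl) , i , λ n i≤n →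
         subst (_∈ at (slalom (r x)) n) (word-glue p y n)
           (word∈slalom {r x} {e} {z} n (i , i≤n , e∈Cᵢ)
             λ j → trans (z≐x⊕e j) (cong (_xor e j) (sym (r≐ x j))))

  summable-dominating : ∀ {X E} → ℰ E → (∀ z → z ∈ₚ X ⊞ E) →
    ∃[ F ] ∃[ b ] Σ[ adm ∈ Admissible F b ] Summable adm ×
    Σ[ Z ∈ Pred (Slm F b) 0ℓ ] Dominating F b Z × subset (SlmSet F b) Z ≲ subset 2^ω X
  summable-dominating {X} ℰE X⊞E = let C , thin , E⊆C = ℰ⇒thin ℰE in
    F thin , b thin , admissible thin , summable thin
    , image {2^ω} {SlmSet _ _} (Func.to (slalomFunc thin)) X , dominating thin E⊆C X⊞E , image-≲ (slalomFunc thin) X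

-- A set outside ℰ* from slaloms

module Blocks (em : Classical) (ac : AxiomOfChoice) where
  open Logic em
  open Choice ac
  open Topology em

  p ℓ : ℕ → ℕ
  p t = proj₁ (log₂ t)
  ℓ = offset p

  NonzeroFrom : ℕ → Pred Cantor 0ℓ
  NonzeroFrom m x = ∀ t → m ≤ℕ t → ¬ ZeroOn (ℓ t) (ℓ (suc t)) x

  -- A point outside vanishes on some block `t` with `m ≤ t`, which its prefix up to the end of that
  -- block already shows.
  nonzero-closed : ∀ m → Closed (NonzeroFrom m)
  nonzero-closed m x x∉ =
    let t , ¬nonzero = ¬∀⇒∃¬ x∉
        m≤t  = by-contradiction λ m≰t → ¬nonzero λ m≤t → contradiction m≤t m≰t
        vanishes = by-contradiction λ nonzero → ¬nonzero λ _ → nonzero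
    in ℓ (suc t) , λ y y∈ y-nonzero →
       y-nonzero t m≤t λ i ℓₜ≤i i< → trans (y∈ i i<) (vanishes i ℓₜ≤i i<)

  nonzeroPrefixes : ℕ → ℕ → List Cantor
  nonzeroPrefixes m zero    = extensions (ℓ m) (λ _ → false) 0
  nonzeroPrefixes m (suc d) =
    concatMap (λ c → nonzeroExtensions (p (d +ℕ m)) c (ℓ (d +ℕ m))) (nonzeroPrefixes m d)

  nonzeroPrefixes-cover : ∀ m d x → x ∈ₚ NonzeroFrom m → Covered (nonzeroPrefixes m d) (ℓ (d +ℕ m)) x
  nonzeroPrefixes-cover m zero    x _  = extensions-cover (ℓ m) λ _ ()
  nonzeroPrefixes-cover m (suc d) x x∈ = concatMap⁺ _
    (Any.map (λ x∈[c] → nonzeroExtensions-cover (p (d +ℕ m)) x∈[c] (x∈ (d +ℕ m) (ℕₚ.m≤n+m m d)))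
      (nonzeroPrefixes-cover m d x x∈))

  -- The density of the prefixes is a product of factors 1 − 2^{-p t}
  -- ≤ 1 − 1/(t+1) = t/(t+1), which telescopes.
  nonzeroPrefixes-length : ∀ m d → length (nonzeroPrefixes m d) *ℕ (d +ℕ m) ≤ℕ suc m *ℕ 2^ (ℓ (d +ℕ m))
  nonzeroPrefixes-length m zero = begin
    length (nonzeroPrefixes m 0) *ℕ m   ≡⟨ cong (_*ℕ m) (length-extensions (ℓ m) _ 0) ⟩
    2^ (ℓ m) *ℕ m                       ≡⟨ ℕₚ.*-comm (2^ (ℓ m)) m ⟩
    m *ℕ 2^ (ℓ m)                       ≤⟨ ℕₚ.*-monoˡ-≤ (2^ (ℓ m)) (ℕₚ.n≤1+n m) ⟩
    suc m *ℕ 2^ (ℓ m)                   ∎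
    where open ℕₚ.≤-Reasoning
  -- Adding `M *ℕ suc t` replaces `M′ = M (K - 1)` by `M′ + M = M K`; the surplus `M *ℕ K` is
  -- absorbed because `K ≤ t + 1`.
  nonzeroPrefixes-length m (suc d) = ℕₚ.+-cancelʳ-≤ (M *ℕ suc t) _ _ (begin
    M′ *ℕ suc t +ℕ M *ℕ suc t         ≡⟨ ℕₚ.*-distribʳ-+ (suc t) M′ M ⟨
    (M′ +ℕ M) *ℕ suc t                ≡⟨ cong (_*ℕ suc t) (concatMap-length _ K (λ c → length-nonzeroExtensions (p t) c (ℓ t)) (nonzeroPrefixes m d)) ⟩
    M *ℕ K *ℕ suc t                   ≡⟨ ℕₚ.*-suc (M *ℕ K) t ⟩
    M *ℕ K +ℕ M *ℕ K *ℕ t             ≡⟨ cong (M *ℕ K +ℕ_) (trans (ℕₚ.*-assoc M K t) (trans (cong (M *ℕ_) (ℕₚ.*-comm K t)) (sym (ℕₚ.*-assoc M t K)))) ⟩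
    M *ℕ K +ℕ M *ℕ t *ℕ K             ≤⟨ ℕₚ.+-mono-≤ (ℕₚ.*-monoʳ-≤ M (proj₁ (proj₂ (log₂ t)))) (ℕₚ.*-monoˡ-≤ K (nonzeroPrefixes-length m d)) ⟩
    M *ℕ suc t +ℕ suc m *ℕ 2^ (ℓ t) *ℕ K   ≡⟨ ℕₚ.+-comm (M *ℕ suc t) _ ⟩
    suc m *ℕ 2^ (ℓ t) *ℕ K +ℕ M *ℕ suc t   ≡⟨ cong (_+ℕ M *ℕ suc t) (trans (ℕₚ.*-assoc (suc m) (2^ (ℓ t)) K) (cong (suc m *ℕ_) (sym (ℕₚ.^-distribˡ-+-* 2 (ℓ t) (p t))))) ⟩
    suc m *ℕ 2^ (ℓ (suc t)) +ℕ M *ℕ suc t  ∎)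
    where
    open ℕₚ.≤-Reasoning
    t  = d +ℕ m
    K  = 2^ (p t)
    M  = length (nonzeroPrefixes m d)
    M′ = length (nonzeroPrefixes m (suc d))

  nonzero-null : ∀ m → Null (NonzeroFrom m)
  nonzero-null m = small-covers⇒null λ e →
    -- Chosen so that the density bound `(m + 1) / (d + m)` is at most `2^(-e)`.
    let d = 2^ e *ℕ suc m in
    ℓ (d +ℕ m) , nonzeroPrefixes m d , measure e d refl , nonzeroPrefixes-cover m d
    where
    open ℕₚ.≤-Reasoning
    measure : ∀ e d → d ≡ 2^ e *ℕ suc m → length (nonzeroPrefixes m d) *ℕ 2^ e ≤ℕ 2^ (ℓ (d +ℕ m))
    measure e d d≡ = ℕₚ.*-cancelˡ-≤ (suc m) (begin
      suc m *ℕ (M *ℕ 2^ e)          ≡⟨ ℕₚ.*-comm (suc m) (M *ℕ 2^ e) ⟩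
      M *ℕ 2^ e *ℕ suc m            ≡⟨ ℕₚ.*-assoc M (2^ e) (suc m) ⟩
      M *ℕ (2^ e *ℕ suc m)          ≡⟨ cong (M *ℕ_) d≡ ⟨
      M *ℕ d                        ≤⟨ ℕₚ.*-monoʳ-≤ M (ℕₚ.m≤m+n d m) ⟩
      M *ℕ (d +ℕ m)                 ≤⟨ nonzeroPrefixes-length m d ⟩
      suc m *ℕ 2^ (ℓ (d +ℕ m))      ∎)
      where M = length (nonzeroPrefixes m d)

  EventuallyNonzero : Pred Cantor 0ℓ
  EventuallyNonzero = ⋃ ℕ NonzeroFrom

  eventuallyNonzero∈ℰ : ℰ EventuallyNonzero
  eventuallyNonzero∈ℰ = union-∈ λ m → closedNull (nonzero-closed m) (nonzero-null m)

  -- F n codes the initial segments of length width n; these contain all blocks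
  -- of length n, as p t = n implies t + 1 < 2^(n+1).
  width F b : ℕ → ℕ
  width n = ℓ (2^ (suc n)) +ℕ n
  F n = 2^ (width n)
  b n = n

  -- Offsets are only weakly monotone; the summand `n` of `width` gives strictness.
  width-increasing : Increasing width
  width-increasing n = ℕₚ.+-mono-≤-< (offset-mono p (2^-mono-≤ (ℕₚ.n≤1+n (suc n)))) (ℕₚ.n<1+n n)

  admissible : Admissible F b
  admissible = record
    { F-increasing = λ n → 2^-mono-< (width-increasing n)
    ; b-increasing = ℕₚ.n<1+n
    ; F≥1          = λ n → ℕₚ.m^n>0 2 (width n)
    ; b≤F          = λ n → ℕₚ.≤-trans (ℕₚ.<⇒≤ (m<2^m n)) (2^-mono-≤ (ℕₚ.m≤n+m n (ℓ (2^ (suc n)))))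
    }

  ℓ≤width : ∀ t → ℓ (suc t) ≤ℕ width (p t)
  ℓ≤width t = ℕₚ.≤-trans (offset-mono p (ℕₚ.<⇒≤ (proj₂ (proj₂ (log₂ t))))) (ℕₚ.m≤m+n _ (p t))

  -- Turns capture at almost all indices `n` into a statement about almost all blocks `t`.
  p-unbounded : ∀ N t → 2^ N ≤ℕ t → N ≤ℕ p t
  p-unbounded N t 2ᴺ≤t = ℕₚ.≮⇒≥ λ pₜ<N → ℕₚ.<-irrefl refl (begin-strict
    t                   <⟨ ℕₚ.n<1+n t ⟩
    suc t               <⟨ proj₂ (proj₂ (log₂ t)) ⟩
    2^ (suc (p t))      ≤⟨ 2^-mono-≤ pₜ<N ⟩
    2^ N                ≤⟨ 2ᴺ≤t ⟩
    t                   ∎)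
    where open ℕₚ.≤-Reasoning

  -- Gluing copies of `w` gives a point whose initial segment is coded by `w`.
  decode : ∀ n → Fin (2^ n) → Cantor
  decode n w = glue (λ _ → n) (λ _ → w)

  word-decode : ∀ n w → word 0 n (decode n w) ≡ w
  word-decode n w = word-glue (λ _ → n) (λ _ → w) 0

  block : ∀ t → Fin (F (p t)) → Fin (2^ (p t))
  block t w = word (ℓ t) (p t) (decode (width (p t)) w)

  block-word : ∀ t z → block t (word 0 (width (p t)) z) ≡ word (ℓ t) (p t) z
  block-word t z = word-cong (ℓ t) (p t) λ i _ i< →
    word-injective 0 (width (p t)) {decode (width (p t)) (word 0 (width (p t)) z)} {z} (word-decode (width (p t)) _) i z≤n (ℕₚ.<-≤-trans i< (ℓ≤width t))

  -- The `p t` codes in `at S (p t)` yield at most `p t` words on block `t`, out of `2^ (p t)`.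
  avoided : ∀ (S : Slm F b) t → ∃[ a ] (∀ {v} → v ∈ at S (p t) → block t v ≢ a)
  avoided S t = avoid (block t) (at S (p t))
    (subst (_<ℕ 2^ (p t)) (sym (size S (p t))) (m<2^m (p t)))

  avoider : Slm F b → Cantor
  avoider S = glue p λ t → proj₁ (avoided S t)

  -- If the sum vanished on the block, `z` would have there the very word that differs from those of
  -- all members of `at S (p t)`.
  avoider-nonzero : ∀ {S z t} → word 0 (width (p t)) z ∈ at S (p t) →
                    ¬ ZeroOn (ℓ t) (ℓ (suc t)) (avoider S ⊕ z)
  avoider-nonzero {S} {z} {t} z∈S vanishes = proj₂ (avoided S t) z∈S (begin
    block t (word 0 (width (p t)) z)   ≡⟨ block-word t z ⟩
    word (ℓ t) (p t) z                 ≡⟨ word-cong (ℓ t) (p t) (λ i ℓ≤i i< → sym (xor≡false⇒≡ (avoider S i) (z i) (vanishes i ℓ≤i i<))) ⟩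
    word (ℓ t) (p t) (avoider S)       ≡⟨ word-glue p _ t ⟩
    proj₁ (avoided S t)                ∎)
    where open ≡-Reasoning

  avoiderFunc : Func (SlmSet F b) 2^ω
  avoiderFunc = respectful avoider

  avoiders : Pred (Slm F b) 0ℓ → Pred Cantor 0ℓ
  avoiders = image {SlmSet F b} {2^ω} (Func.to avoiderFunc)

  -- Write `z` as `x ⊕ (x ⊕ z)`, where `x` avoids a slalom capturing the initial segments of `z`
  -- from `N` on. Blocks from `2^ N` on have length at least `N`, so `x ⊕ z` is nonzero on them.
  avoiders⊞E : ∀ {Z} → Dominating F b Z → ∀ z → z ∈ₚ avoiders Z ⊞ EventuallyNonzero
  avoiders⊞E dom z =
    let S , S∈Z , N , z∈S = dom λ n → word 0 (width n) z
        r , r≈ , _ = canonical (SlmSet F b)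
        x = avoider (r S)
    in x , x ⊕ z , (S , S∈Z , λ _ → refl)
       , (2^ N , λ t 2ᴺ≤t → avoider-nonzero {r S} {z} {t}
            (subst (_ ∈_) (sym (r≈ S (p t))) (z∈S (p t) (p-unbounded N t 2ᴺ≤t))))
       , λ i → sym (xor-cancelˡ (x i) (z i))

  avoiders∉ℰ* : ∀ {Z} → Dominating F b Z → ∁ ℰ* (avoiders Z)
  avoiders∉ℰ* dom ∈ℰ* = ∈ℰ* EventuallyNonzero eventuallyNonzero∈ℰ (avoiders⊞E dom)

  subset-through : ∀ n (v : Fin (F n)) → Σ[ S ∈ Subset (F n) ] ∣ S ∣ ≡ n × (1 ≤ℕ n → v ∈ S)
  subset-through zero    v = let S , ∣S∣≡0 , _ = enlarge ∅ 0 (ℕₚ.≤-reflexive (Subₚ.∣⊥∣≡0 (F 0))) z≤n in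
    S , ∣S∣≡0 , λ ()
  subset-through (suc n) v =
    let S , ∣S∣≡n , v⊆S = enlarge ⁅ v ⁆ (suc n)
          (ℕₚ.≤-trans (ℕₚ.≤-reflexive (Subₚ.∣⁅x⁆∣≡1 v)) (s≤s z≤n)) (Admissible.b≤F admissible (suc n))
    in S , ∣S∣≡n , λ _ → v⊆S (Subₚ.x∈⁅x⁆ v)

  -- Provides the dominating family from which `min-exists` obtains the cardinal. As `b 0 = 0`,
  -- capture begins at index 1.
  all-dominating : Dominating F b U
  all-dominating x =
    record { at   = λ n → proj₁ (subset-through n (x n))
           ; size = λ n → proj₁ (proj₂ (subset-through n (x n))) }
    , _ , 1 , λ n → proj₂ (proj₂ (subset-through n (x n)))

-- The two inequalities

theorem4p6 : Classical → AxiomOfChoice →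
    ∀ (nonℰ* : Cardinal) → IsNonℰ* nonℰ* →
    (∀ (s : Cardinal) → IsSup 𝔡s s → nonℰ* ≲ s) ×
    (∀ (m : Cardinal) → IsMin summable-𝔡s m → m ≲ nonℰ*)
theorem4p6 em ac nonℰ* ((X , X∉ℰ* , nonℰ*≃X) , nonℰ*-least) = upper , lower
  where
  open Logic em
  open Choice ac
  open Summables em ac using (summable-dominating)
  open Blocks em ac

  upper : ∀ s → IsSup 𝔡s s → nonℰ* ≲ s
  upper s (s-bounds , _) =
    -- The avoiders of a dominating family `Z` of least size lie outside `ℰ*` and number at most
    -- `κ`, which the supremum bounds.
    let κ , Is𝔡-κ@((Z , dom , κ≃Z) , _) = min-exists {A = SlmSet F b} {P = Dominating F b} all-dominating
    in ≲-trans (nonℰ*-least _ (avoiders Z , avoiders∉ℰ* dom , Id.bijection _))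
         (≲-trans (image-≲ avoiderFunc Z)
           (≲-trans (≃⇒≳ κ≃Z) (s-bounds κ (F , b , admissible , Is𝔡-κ))))

  lower : ∀ m → IsMin summable-𝔡s m → m ≲ nonℰ*
  lower m (_ , m-least) =
    -- A witness `E` against `ℰ* X` yields a summable pair with a dominating family no larger than
    -- `X`.
    let E , ℰE , X⊞E = by-contradiction λ none → X∉ℰ* λ E ℰE X⊞E → none (E , ℰE , X⊞E)
        F , b , adm , summable , Z , dom , Z≲X = summable-dominating ℰE X⊞E
        κ , Is𝔡-κ@(_ , κ-least) = min-exists {A = SlmSet F b} {P = Dominating F b} dom
    in ≲-trans (m-least κ (F , b , adm , summable , Is𝔡-κ))
         (≲-trans (κ-least _ (Z , dom , Id.bijection _))
           (≲-trans Z≲X (≃⇒≳ nonℰ*≃X)))
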